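{- Let $n$ be a positive integer and $L$ a skew $(p,q)$-leaper with $p<q$. Then the leaper graph of $L$ over the pinwheel board $W_n(L)$ is trivial (it contains no nontrivial cycle) and the direction graph extracted from it depends only on $n$ (and not on $L$). Denote this direction graph by $W_n$, the pinwheel direction graph of order $n$. (This continues to apply to non-skew $(p,q)$-leapers $L$ with $p<q$ in the sense that the leaper graph of $L$ over $W_n(L)$ is an $L$-instantiation of $W_n$.) The pinwheel direction graph $W_n$ is a dual direction graph of complement $\pi_{\mathrm{Pinwheel}}(W_n)$ when $n$ is odd, and $\pi_{\mathrm{Reflect}}\circ\pi_{\mathrm{Pinwheel}}(W_n)$ when $n$ is even, and duality matrix $A^{\mathrm{Pinwheel}}_n=\begin{pmatrix}0&1\\1&2n\end{pmatrix}$, where $\pi_{\mathrm{Pinwheel}}$ is the permutation of the eight skew directions sending $1,2,3,4,5,6,7,8$ to $3,8,5,2,7,4,1,6$ respectively (an equivalence permutation, induced by the unit $2\times2$ matrix and $\begin{pmatrix}0&1\\-1&0\end{pmatrix}$), and $\pi_{\mathrm{Reflect}}(i)=9-i$.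
   Context: A square is a unit square of the infinite chessboard; a board is a set of squares. For nonnegative integers $p,q$, not both zero, a $(p,q)$-leaper is a piece that moves from a square $a$ to any of $a+(\pm p,\pm q)$, $a+(\pm q,\pm p)$; it is skew if $p,q$ are nonzero and distinct. The leaper graph of $L$ over a board $B$ has the squares of $B$ as vertices, two being adjacent when a move of $L$ joins them. Pinwheel boards. Given a $(p,q)$-leaper $L$ with $q\ne0$, use Cartesian coordinates with origin $O$ over the infinite chessboard such that the integer points are the vertices of the squares if $p+q$ is odd, and the centers of the squares if $p+q$ is even; $(x,y)$ denotes the square centered at $(x,y)$. Let $N^{\mathrm I}(L)$ be the set of all squares $(x,y)$ with $x\equiv\frac12(p+q)$ and $y\equiv\frac12(p-q)$ modulo $2q$. Let $R^{\mathrm I}_n(L)$ be the rectangle bounded by $p\le x+y\le p+2nq$ and $-(2n-1)q\le y-x\le(2n-1)q$, and let $W^{\mathrm I}_n(L)$ be the board formed by all squares of $N^{\mathrm I}(L)$ whose centers lie on the boundary or in the interior of $R^{\mathrm I}_n(L)$. Let $W^{\mathrm{II}}_n(L)$, $W^{\mathrm{III}}_n(L)$, $W^{\mathrm{IV}}_n(L)$ be the rotations of $W^{\mathrm I}_n(L)$ by $90^\circ$, $180^\circ$, and $270^\circ$ counterclockwise about $O$. The pinwheel board $W_n(L)$ of order $n$ for $L$ is the union of these four boards. Direction graphs. Let $A_1=\begin{pmatrix}0&1\\1&0\end{pmatrix}$, $A_2=\begin{pmatrix}1&0\\0&1\end{pmatrix}$, $A_3=\begin{pmatrix}-1&0\\0&1\end{pmatrix}$,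 $A_4=\begin{pmatrix}0&-1\\1&0\end{pmatrix}$, and $A_{i+4}=-A_i$ for $i=1,\ldots,4$; these eight are the direction matrices. A move of a skew $(p,q)$-leaper, $p<q$, by a translation $v$ has (skew) direction $i\in\{1,\ldots,8\}$ and direction matrix $A_i$ if $v^T=A_i\binom pq$. A direction graph is a symmetric directed graph whose arcs are labeled with skew directions so that the sum of the associated direction matrices over every simple directed cycle (including two-cycles) is zero. Two direction graphs are the same if there is a label-preserving isomorphism between them. A simple cycle of a skew leaper is trivial if the sum of the direction matrices of its moves (in either orientation) is zero, and nontrivial otherwise. If a leaper graph $G$ of a skew leaper contains no nontrivial cycle, the direction graph extracted from $G$ has the squares of $G$ as vertices and, for each pair of adjacent squares $a,b$, an arc from $a$ to $b$ and an arc from $b$ to $a$, each labeled with the direction of the corresponding move. For an arbitrary $(p,q)$-leaper $L$, $p\le q$, a graph $G$ whose vertices are squares is an $L$-instantiation of a direction graph $\Phi$ if there is a mapping $\tau$ from the vertices of $\Phi$ to the vertices of $G$ such that for every arc in $\Phi$ from $x$ to $y$ labeled $i$, the move by the translation $v$ with $v^T=A_i\binom pq$ leads from $\tau(x)$ to $\tau(y)$. Equivalence permutations. A permutation $\pi$ of the eight skew directions is an equivalence permutation, induced by real $2\times2$ matrices $P$ and $Q$, if $A_{\pi(i)}=PA_iQ$ for all $i$; $\pi(\Phi)$ is obtained from $\Phi$ by applying $\pi$ to every arc label. Duality. For vertices $x,y$ in the same connected component of a direction graph, the distance from $x$ to $y$ is the sum of the direction matrices along any path from $x$ to $y$ (it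 does not depend on the path). A direction graph is coherent if, for all such $x,y$, the distance from $x$ to $y$ is the zero matrix if and only if $x=y$, and is a direction matrix if and only if $x$ and $y$ are joined by an arc. A direction graph $\Phi$ is dual if there exist a direction graph $\Phi'$ (a complement of $\Phi$), a one-to-one mapping $\eta$ between the vertex sets of $\Phi$ and $\Phi'$, and a real $2\times2$ matrix $A_{\mathrm{Dual}}$ (the duality matrix), distinct from all direction matrices, such that: $\Phi$ and $\Phi'$ are coherent and connected; the unlabeled symmetric directed graphs underlying $\Phi$ and $\Phi'$ are isomorphic; and for every arc from $\eta(a)$ to $\eta(b)$ labeled $i$ in $\Phi'$, the distance from $a$ to $b$ in $\Phi$ equals $A_iA_{\mathrm{Dual}}$. -}

module Defs where

open import Data.Integer as ℤ using (ℤ; +_; 0ℤ; 1ℤ; -1ℤ; _◃_)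
open import Data.Integer.Divisibility using (_∣_)
open import Data.List using (List; []; _∷_; foldr; length; map)
open import Data.List.Relation.Unary.Unique.Propositional using (Unique)
open import Data.Nat as ℕ using (ℕ)
open import Data.Nat.DivMod using (_%_)
open import Data.Product using (∃-syntax; Σ-syntax; _×_; _,_)
open import Data.Refinement using (Refinement; value)
open import Data.Sign using (Sign)
open import Data.Sum using (_⊎_)
open import Function.Bundles using (Inverse; _↔_; _⇔_; mk↔ₛ′)
open import Level using (0ℓ)
open import Relation.Binary.Construct.Closure.ReflexiveTransitive using (Star; ε; _◅_)
open import Relation.Binary.Core using (Rel)
open import Relation.Binary.PropositionalEquality using (_≡_; _≢_; refl)
open import Relation.Unary using (Pred; _∪_)

-- Every matrix occurring below is integral, so no larger ring of
-- entries is needed.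

record Matrix : Set where
  constructor mat
  field
    a₁₁ a₁₂ a₂₁ a₂₂ : ℤ

infixl 6 _+ᴹ_
infixl 7 _*ᴹ_

_+ᴹ_ : Matrix → Matrix → Matrix
mat a b c d +ᴹ mat a′ b′ c′ d′ =
  mat (a ℤ.+ a′) (b ℤ.+ b′) (c ℤ.+ c′) (d ℤ.+ d′)

-ᴹ_ : Matrix → Matrix
-ᴹ mat a b c d = mat (ℤ.- a) (ℤ.- b) (ℤ.- c) (ℤ.- d)

_*ᴹ_ : Matrix → Matrix → Matrix
mat a b c d *ᴹ mat a′ b′ c′ d′ =
  mat (a ℤ.* a′ ℤ.+ b ℤ.* c′) (a ℤ.* b′ ℤ.+ b ℤ.* d′)
      (c ℤ.* a′ ℤ.+ d ℤ.* c′) (c ℤ.* b′ ℤ.+ d ℤ.* d′)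

0ᴹ 1ᴹ : Matrix
0ᴹ = mat 0ℤ 0ℤ 0ℤ 0ℤ
1ᴹ = mat 1ℤ 0ℤ 0ℤ 1ℤ

_·_ : Matrix → ℤ × ℤ → ℤ × ℤ
mat a b c d · (x , y) = a ℤ.* x ℤ.+ b ℤ.* y , c ℤ.* x ℤ.+ d ℤ.* y

data Direction : Set where
  d₁ d₂ d₃ d₄ d₅ d₆ d₇ d₈ : Direction

A : Direction → Matrix
A d₁ = mat 0ℤ 1ℤ
           1ℤ 0ℤ
A d₂ = mat 1ℤ 0ℤ
           0ℤ 1ℤ
A d₃ = mat -1ℤ 0ℤ
            0ℤ 1ℤ
A d₄ = mat 0ℤ -1ℤ
           1ℤ  0ℤ
A d₅ = -ᴹ A d₁
A d₆ = -ᴹ A d₂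
A d₇ = -ᴹ A d₃
A d₈ = -ᴹ A d₄

matrixSum : List Direction → Matrix
matrixSum is = foldr _+ᴹ_ 0ᴹ (map A is)

Permutation : Set
Permutation = Direction ↔ Direction

-- π is an equivalence permutation, induced by P and Q.
IsInducedBy : Permutation → Matrix → Matrix → Set
IsInducedBy π P Q = ∀ i → A (Inverse.to π i) ≡ P *ᴹ A i *ᴹ Q

πPinwheel : Permutation
πPinwheel = mk↔ₛ′ to from
  (λ { d₁ → refl ; d₂ → refl ; d₃ → refl ; d₄ → refl
     ; d₅ → refl ; d₆ → refl ; d₇ → refl ; d₈ → refl })
  (λ { d₁ → refl ; d₂ → refl ; d₃ → refl ; d₄ → refl
     ; d₅ → refl ; d₆ → refl ; d₇ → refl ; d₈ → refl })
  where
  to : Direction → Direction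
  to d₁ = d₃
  to d₂ = d₈
  to d₃ = d₅
  to d₄ = d₂
  to d₅ = d₇
  to d₆ = d₄
  to d₇ = d₁
  to d₈ = d₆

  from : Direction → Direction
  from d₁ = d₇
  from d₂ = d₄
  from d₃ = d₁
  from d₄ = d₆
  from d₅ = d₃
  from d₆ = d₈
  from d₇ = d₅
  from d₈ = d₂

πReflect : Permutation
πReflect = mk↔ₛ′ to to involutive involutive
  where
  to : Direction → Direction
  to d₁ = d₈
  to d₂ = d₇
  to d₃ = d₆
  to d₄ = d₅
  to d₅ = d₄
  to d₆ = d₃
  to d₇ = d₂
  to d₈ = d₁

  involutive : ∀ i → to (to i) ≡ i
  involutive d₁ = refl
  involutive d₂ = refl
  involutive d₃ = refl
  involutive d₄ = refl
  involutive d₅ = refl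
  involutive d₆ = refl
  involutive d₇ = refl
  involutive d₈ = refl

Walk : {V : Set} → Rel V 0ℓ → Rel V 0ℓ
Walk _~_ = Star _~_

-- All vertices of a walk except the final one.
sources : {V : Set} {_~_ : Rel V 0ℓ} {x y : V} → Walk _~_ x y → List V
sources ε                 = []
sources (_◅_ {i = x} _ w) = x ∷ sources w

-- A simple cycle of length at least k.
IsSimpleCycle : {V : Set} {_~_ : Rel V 0ℓ} {x : V} → ℕ → Walk _~_ x x → Set
IsSimpleCycle k w = k ℕ.≤ length (sources w) × Unique (sources w)

-- Arc x i y: there is an arc from x to y, and it is labeled i.
record LabeledDigraph : Set₁ where
  field
    Vertex : Set
    Arc    : Vertex → Direction → Vertex → Set

  Joined : Rel Vertex 0ℓ
  Joined x y = ∃[ i ] Arc x i y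

  labels : ∀ {x y} → Walk Joined x y → List Direction
  labels ε             = []
  labels ((i , _) ◅ w) = i ∷ labels w

open LabeledDigraph public

record IsDirectionGraph (Φ : LabeledDigraph) : Set where
  field
    symmetric   : ∀ {x y} → Joined Φ x y → Joined Φ y x
    uniqueLabel : ∀ {x y i j} → Arc Φ x i y → Arc Φ x j y → i ≡ j
    -- Two-cycles count as simple directed cycles.  A loop would count
    -- too; its sum is never zero, so loops are excluded.
    cycleSum    : ∀ {x} (w : Walk (Joined Φ) x x) → IsSimpleCycle 1 w →
                  matrixSum (labels Φ w) ≡ 0ᴹ

infix 4 _≅_

_≅_ : LabeledDigraph → LabeledDigraph → Set
Φ ≅ Ψ = Σ[ f ∈ Vertex Φ ↔ Vertex Ψ ]
  (∀ x i y → Arc Φ x i y ⇔ Arc Ψ (Inverse.to f x) i (Inverse.to f y))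

UnderlyingIsomorphic : LabeledDigraph → LabeledDigraph → Set
UnderlyingIsomorphic Φ Ψ = Σ[ f ∈ Vertex Φ ↔ Vertex Ψ ]
  (∀ x y → Joined Φ x y ⇔ Joined Ψ (Inverse.to f x) (Inverse.to f y))

relabel : Permutation → LabeledDigraph → LabeledDigraph
relabel π Φ = record
  { Vertex = Vertex Φ
  ; Arc    = λ x j y → ∃[ i ] (Arc Φ x i y × Inverse.to π i ≡ j)
  }

IsDistance : (Φ : LabeledDigraph) → Vertex Φ → Vertex Φ → Matrix → Set
IsDistance Φ x y M =
  Walk (Joined Φ) x y ×
  (∀ (w : Walk (Joined Φ) x y) → matrixSum (labels Φ w) ≡ M)

IsConnected : LabeledDigraph → Set
IsConnected Φ = ∀ x y → Walk (Joined Φ) x y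

record IsCoherent (Φ : LabeledDigraph) : Set where
  field
    zero-distance      : ∀ {x y} → Walk (Joined Φ) x y →
                         IsDistance Φ x y 0ᴹ ⇔ x ≡ y
    direction-distance : ∀ {x y} → Walk (Joined Φ) x y →
                         (∃[ i ] IsDistance Φ x y (A i)) ⇔ Joined Φ x y

-- Φ is dual, with complement Φ′ and duality matrix D.
record IsDual (Φ Φ′ : LabeledDigraph) (D : Matrix) : Set where
  field
    directionGraph  : IsDirectionGraph Φ
    directionGraph′ : IsDirectionGraph Φ′
    D-notDirection  : ∀ i → D ≢ A i
    coherent        : IsCoherent Φ
    coherent′       : IsCoherent Φ′
    connected       : IsConnected Φ
    connected′      : IsConnected Φ′
    underlying      : UnderlyingIsomorphic Φ Φ′
    η               : Vertex Φ ↔ Vertex Φ′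
    distances       : ∀ a b i → Arc Φ′ (Inverse.to η a) i (Inverse.to η b) →
                      IsDistance Φ a b (A i *ᴹ D)

Square : Set
Square = ℤ × ℤ

infixl 6 _⊕_ _⊖_

_⊕_ _⊖_ : ℤ × ℤ → ℤ × ℤ → ℤ × ℤ
(x , y) ⊕ (x′ , y′) = x ℤ.+ x′ , y ℤ.+ y′
(x , y) ⊖ (x′ , y′) = x ℤ.- x′ , y ℤ.- y′

Board : Set₁
Board = Pred Square 0ℓ

record SquareGraph : Set₁ where
  field
    board : Board

  -- Membership proofs are irrelevant: distinct vertices are distinct squares.
  SquareOf : Set
  SquareOf = Refinement Square board

  field
    Adjacent : Rel SquareOf 0ℓ

open SquareGraph public

record Leaper : Set where
  field
    p q         : ℕ
    notBothZero : p ≢ 0 ⊎ q ≢ 0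

open Leaper public

IsSkew : Leaper → Set
IsSkew L = p L ≢ 0 × q L ≢ 0 × p L ≢ q L

IsMove : Leaper → ℤ × ℤ → Set
IsMove L v = Σ[ s ∈ Sign ] Σ[ t ∈ Sign ]
  (v ≡ (s ◃ p L , t ◃ q L) ⊎ v ≡ (s ◃ q L , t ◃ p L))

leaperGraph : Leaper → Board → SquareGraph
leaperGraph L B = record
  { board    = B
  ; Adjacent = λ a b → IsMove L (value b ⊖ value a)
  }

directionVector : Leaper → Direction → ℤ × ℤ
directionVector L i = A i · (+ p L , + q L)

module _ (L : Leaper) (B : Board) where

  private
    G : SquareGraph
    G = leaperGraph L B

  -- Directions w is: the successive moves of w have the directions is.
  data Directions : {a b : SquareOf G} →
                    Walk (Adjacent G) a b → List Direction → Set where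
    []  : ∀ {a} → Directions {a} ε []
    _∷_ : ∀ {a b c : SquareOf G} {i is}
            {m : Adjacent G a b} {w : Walk (Adjacent G) b c} →
          value b ⊖ value a ≡ directionVector L i →
          Directions w is → Directions {a} (m ◅ w) (i ∷ is)

  IsTrivialCycle : {a : SquareOf G} → Walk (Adjacent G) a a → Set
  IsTrivialCycle w = ∃[ is ] (Directions w is × matrixSum is ≡ 0ᴹ)

  IsTrivialLeaperGraph : Set
  IsTrivialLeaperGraph =
    ∀ {a} (w : Walk (Adjacent G) a a) → IsSimpleCycle 3 w → IsTrivialCycle w

  extracted : LabeledDigraph
  extracted = record
    { Vertex = SquareOf G
    ; Arc    = λ a i b → Adjacent G a b × value b ⊖ value a ≡ directionVector L i
    }

IsInstantiation : Leaper → LabeledDigraph → SquareGraph → Set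
IsInstantiation L Φ G = Σ[ τ ∈ (Vertex Φ → SquareOf G) ]
  (∀ x i y → Arc Φ x i y → value (τ y) ≡ value (τ x) ⊕ directionVector L i)

-- All coordinates here are doubled: (X , Y) stands for the point
-- (X/2 , Y/2) relative to the origin O, so that the formulas for the
-- congruences and for the rectangle appear multiplied by 2.

-- O is the center of the square (0 , 0) when p + q is even, and its
-- lower left vertex when p + q is odd.
center : Leaper → Square → ℤ × ℤ
center L (a , b) = + 2 ℤ.* a ℤ.+ r , + 2 ℤ.* b ℤ.+ r
  where
  r : ℤ
  r = + ((p L ℕ.+ q L) % 2)

module _ (n : ℕ) (L : Leaper) where

  private
    P Q N : ℤ
    P = + p L
    Q = + q L
    N = + n

  Nᴵ : Pred (ℤ × ℤ) 0ℓ
  Nᴵ (X , Y) = + 4 ℤ.* Q ∣ X ℤ.- (P ℤ.+ Q) × + 4 ℤ.* Q ∣ Y ℤ.- (P ℤ.- Q)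

  Rᴵ : Pred (ℤ × ℤ) 0ℓ
  Rᴵ (X , Y) =
      + 2 ℤ.* P ℤ.≤ X ℤ.+ Y
    × X ℤ.+ Y ℤ.≤ + 2 ℤ.* (P ℤ.+ + 2 ℤ.* N ℤ.* Q)
    × ℤ.- (+ 2 ℤ.* ((+ 2 ℤ.* N ℤ.- 1ℤ) ℤ.* Q)) ℤ.≤ Y ℤ.- X
    × Y ℤ.- X ℤ.≤ + 2 ℤ.* ((+ 2 ℤ.* N ℤ.- 1ℤ) ℤ.* Q)

  Wᴵ : Pred (ℤ × ℤ) 0ℓ
  Wᴵ c = Nᴵ c × Rᴵ c

-- A point belongs to the counterclockwise rotation of S by 90° about O
-- when its clockwise rotation belongs to S.
rotated : Pred (ℤ × ℤ) 0ℓ → Pred (ℤ × ℤ) 0ℓ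
rotated S (X , Y) = S (Y , ℤ.- X)

pinwheelBoard : ℕ → Leaper → Board
pinwheelBoard n L s =
  (Wᴵ n L ∪ rotated (Wᴵ n L) ∪ rotated (rotated (Wᴵ n L))
          ∪ rotated (rotated (rotated (Wᴵ n L)))) (center L s)

πPinwheelMatrix : Matrix
πPinwheelMatrix = mat  0ℤ 1ℤ
                      -1ℤ 0ℤ

A-pinwheel : ℕ → Matrix
A-pinwheel n = mat 0ℤ 1ℤ
                   1ℤ (+ 2 ℤ.* + n)

{-# OPTIONS --safe #-}
module Submission where

-- The squares of a pinwheel board can be named independently of the leaper.
-- In doubled coordinates, the center of each square is
-- (p + q, p - q) + 2 M (p, q) for an integer matrix M, its position, taken
-- from a finite set that depends only on n.  The pinwheel graph has these
-- positions as vertices, with an arc labeled i from x to y when the position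
-- of y exceeds that of x by A i.
--
-- Positions form an injective potential for this graph.  Sums of direction
-- matrices along walks telescope to differences of positions, so cycle sums
-- vanish, distances are differences of positions, and coherence holds by the
-- definition of the arcs (module Potential).  A permutation of the labels
-- that is realized by an additive injection T of matrices turns a potential φ
-- into the potential T ∘ φ (relabel-potential).
--
-- For every leaper with p < q, a shift of position by A i moves the square by
-- the translation A i (p, q), which gives the instantiation.  In the skew
-- case the converse is needed: two squares that coincide, or that differ by
-- such a translation, have positions that are equal or differ by A i
-- (shift-determined).  The discrepancy is a matrix that annihilates (p, q),
-- has entries at most 2 in absolute value in its first column, and is
-- congruent modulo 2 to a matrix with rows (a, b) and (b, a).  Because
-- 0 < p < q, a row (e, f) with |e| ≤ 2 and e p + f q = 0 is zero or has
-- |e| = 2 and |f| = 1.  Hence the first column is even, hence all entries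
-- are even, hence all are zero.  No coprimality of p and q is involved.
-- Thus the extracted direction graph is the pinwheel graph, and the directions
-- along any closed walk sum to zero.
--
-- Connectedness follows by descent: with each of the four rectangles rotated
-- back to the first and indexed by k and l, a cell with l - k ≥ 1 has a
-- neighbor with smaller |k| + |l|, and from every other cell except k = l = 0
-- at most two steps that preserve |k| + |l| lead to one with l - k ≥ 1
-- (shrink-or-origin).
--
-- Duality holds because relabeling acts on positions by right multiplication
-- with a quarter-turn and, for even n, left multiplication with a reflection,
-- and the resulting potential times the duality matrix is, up to a constant,
-- the position of another cell: its image under the half-turn of its
-- rectangle for odd n, and under an exchange of rectangles for even n
-- (position-η in the modules Odd and Even).

open import Defs
open import Data.Empty using (⊥-elim)
open import Data.Integer as ℤ using (ℤ; +_; -[1+_]; 0ℤ; 1ℤ; -1ℤ; ∣_∣; _◃_)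
import Data.Integer.Divisibility.Signed as ℤ
import Data.Integer.Properties as ℤ
open import Algebra.Properties.AbelianGroup ℤ.+-0-abelianGroup
  using () renaming (∙-cancelˡ to +-cancelˡ; ∙-cancelʳ to +-cancelʳ)
open import Data.Integer.Tactic.RingSolver using (solve-∀)
open import Data.Irrelevant using ([_])
open import Data.List using (List; []; _∷_)
open import Data.Nat as ℕ using (ℕ; zero; suc; _<_)
open import Data.Nat.Divisibility using (_∣_; divides; _∣?_; _∣0; ∣⇒≤; m%n≡0⇒n∣m)
open import Data.Nat.DivMod using (_%_; _/_; m≡m%n+[m/n]*n; m%n<n)
import Data.Nat.Properties as ℕ
open import Data.Product using (_×_; _,_; ∃-syntax; Σ-syntax; map₂; proj₁; proj₂)
open import Data.Refinement using (value; _,_)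
open import Data.Refinement.Properties using (value-injective)
open import Data.Sign as Sign using (Sign)
open import Data.Sum using (_⊎_; inj₁; inj₂)
open import Function using (_∘_)
open import Function.Bundles using (Inverse; Equivalence; _↔_; _⇔_; mk⇔; mk↔ₛ′)
open import Function.Construct.Composition using (_⇔-∘_)
open import Function.Construct.Identity using (↔-id)
open import Relation.Binary.Construct.Closure.ReflexiveTransitive as Star
  using (ε; _◅_; _◅◅_)
open import Relation.Binary.PropositionalEquality
  using (_≡_; _≢_; refl; sym; trans; cong; cong₂; subst; module ≡-Reasoning)
open import Relation.Nullary using (¬_; Dec; contradiction; recompute)
open import Relation.Nullary.Decidable using (_×-dec_; _⊎-dec_; map′)

-- Matrices and directions.

mat-cong : ∀ {a b c d a′ b′ c′ d′} → a ≡ a′ → b ≡ b′ → c ≡ c′ → d ≡ d′ →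
           mat a b c d ≡ mat a′ b′ c′ d′
mat-cong refl refl refl refl = refl

+ᴹ-assoc : ∀ X Y Z → X +ᴹ Y +ᴹ Z ≡ X +ᴹ (Y +ᴹ Z)
+ᴹ-assoc (mat a b c d) (mat a′ b′ c′ d′) (mat a″ b″ c″ d″) =
  mat-cong (ℤ.+-assoc a a′ a″) (ℤ.+-assoc b b′ b″)
           (ℤ.+-assoc c c′ c″) (ℤ.+-assoc d d′ d″)

+ᴹ-comm : ∀ X Y → X +ᴹ Y ≡ Y +ᴹ X
+ᴹ-comm (mat a b c d) (mat a′ b′ c′ d′) =
  mat-cong (ℤ.+-comm a a′) (ℤ.+-comm b b′) (ℤ.+-comm c c′) (ℤ.+-comm d d′)

+ᴹ-identityʳ : ∀ X → X +ᴹ 0ᴹ ≡ X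
+ᴹ-identityʳ (mat a b c d) =
  mat-cong (ℤ.+-identityʳ a) (ℤ.+-identityʳ b) (ℤ.+-identityʳ c) (ℤ.+-identityʳ d)

+ᴹ-inverseʳ : ∀ X → X +ᴹ -ᴹ X ≡ 0ᴹ
+ᴹ-inverseʳ (mat a b c d) =
  mat-cong (ℤ.+-inverseʳ a) (ℤ.+-inverseʳ b) (ℤ.+-inverseʳ c) (ℤ.+-inverseʳ d)

+ᴹ-add-subtract : ∀ X Y → X ≡ X +ᴹ Y +ᴹ -ᴹ Y
+ᴹ-add-subtract X Y = sym (begin
  X +ᴹ Y +ᴹ -ᴹ Y    ≡⟨ +ᴹ-assoc X Y (-ᴹ Y) ⟩
  X +ᴹ (Y +ᴹ -ᴹ Y)  ≡⟨ cong (X +ᴹ_) (+ᴹ-inverseʳ Y) ⟩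
  X +ᴹ 0ᴹ           ≡⟨ +ᴹ-identityʳ X ⟩
  X                 ∎)
  where open ≡-Reasoning

+ᴹ-cancelˡ : ∀ X {Y Z} → X +ᴹ Y ≡ X +ᴹ Z → Y ≡ Z
+ᴹ-cancelˡ X {Y} {Z} eq = begin
  Y                ≡⟨ +ᴹ-add-subtract Y X ⟩
  Y +ᴹ X +ᴹ -ᴹ X   ≡⟨ cong (_+ᴹ -ᴹ X) (+ᴹ-comm Y X) ⟩
  X +ᴹ Y +ᴹ -ᴹ X   ≡⟨ cong (_+ᴹ -ᴹ X) eq ⟩
  X +ᴹ Z +ᴹ -ᴹ X   ≡⟨ cong (_+ᴹ -ᴹ X) (+ᴹ-comm X Z) ⟩
  Z +ᴹ X +ᴹ -ᴹ X   ≡⟨ +ᴹ-add-subtract Z X ⟨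
  Z                ∎
  where open ≡-Reasoning

*ᴹ-distribʳ-+ᴹ : ∀ Z X Y → (X +ᴹ Y) *ᴹ Z ≡ X *ᴹ Z +ᴹ Y *ᴹ Z
*ᴹ-distribʳ-+ᴹ (mat a b c d) (mat a′ b′ c′ d′) (mat a″ b″ c″ d″) =
  mat-cong (entry a′ a″ b′ b″ a c) (entry a′ a″ b′ b″ b d)
           (entry c′ c″ d′ d″ a c) (entry c′ c″ d′ d″ b d)
  where
  entry : ∀ x x′ y y′ z w →
          (x ℤ.+ x′) ℤ.* z ℤ.+ (y ℤ.+ y′) ℤ.* w ≡
          (x ℤ.* z ℤ.+ y ℤ.* w) ℤ.+ (x′ ℤ.* z ℤ.+ y′ ℤ.* w)
  entry = solve-∀

-- A left inverse of A, arbitrary off the direction matrices.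
decode : Matrix → Direction
decode (mat (+ 0)    (+ _)    (+ _)    _)        = d₁
decode (mat (+ 0)    (+ _)    -[1+ _ ] _)        = d₈
decode (mat (+ 0)    -[1+ _ ] (+ _)    _)        = d₄
decode (mat (+ 0)    -[1+ _ ] -[1+ _ ] _)        = d₅
decode (mat (+ _)    _        _        (+ _))    = d₂
decode (mat (+ _)    _        _        -[1+ _ ]) = d₇
decode (mat -[1+ _ ] _        _        (+ _))    = d₃
decode (mat -[1+ _ ] _        _        -[1+ _ ]) = d₆

decode-A : ∀ i → decode (A i) ≡ i
decode-A d₁ = refl
decode-A d₂ = refl
decode-A d₃ = refl
decode-A d₄ = refl
decode-A d₅ = refl
decode-A d₆ = refl
decode-A d₇ = refl
decode-A d₈ = refl

A-injective : ∀ {i j} → A i ≡ A j → i ≡ j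
A-injective {i} {j} eq =
  trans (sym (decode-A i)) (trans (cong decode eq) (decode-A j))

opposite : ∀ i → ∃[ j ] A j ≡ -ᴹ A i
opposite d₁ = d₅ , refl
opposite d₂ = d₆ , refl
opposite d₃ = d₇ , refl
opposite d₄ = d₈ , refl
opposite d₅ = d₁ , refl
opposite d₆ = d₂ , refl
opposite d₇ = d₃ , refl
opposite d₈ = d₄ , refl

-- Direction graphs given by a potential.

-- An injective placement φ of the vertices among the 2 × 2 matrices such
-- that an arc labeled i leads from x to y exactly when φ y - φ x = A i.
record IsPotential (Φ : LabeledDigraph) (φ : Vertex Φ → Matrix) : Set where
  field
    arc⇔      : ∀ x i y → Arc Φ x i y ⇔ φ y ≡ φ x +ᴹ A i
    injective : ∀ {x y} → φ x ≡ φ y → x ≡ y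

  arc⇒ : ∀ {x i y} → Arc Φ x i y → φ y ≡ φ x +ᴹ A i
  arc⇒ = Equivalence.to (arc⇔ _ _ _)

  arc⇐ : ∀ {x i y} → φ y ≡ φ x +ᴹ A i → Arc Φ x i y
  arc⇐ = Equivalence.from (arc⇔ _ _ _)

module Potential {Φ : LabeledDigraph} {φ : Vertex Φ → Matrix}
                 (isPotential : IsPotential Φ φ) where

  open IsPotential isPotential
  open ≡-Reasoning

  -- The distance from x to y is φ y - φ x.
  telescope : ∀ {x y} (w : Walk (Joined Φ) x y) →
              φ y ≡ φ x +ᴹ matrixSum (labels Φ w)
  telescope {x} ε = sym (+ᴹ-identityʳ (φ x))
  telescope {x} {y} (_◅_ {j = z} (i , arc) w) = begin
    φ y                                          ≡⟨ telescope w ⟩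
    φ z +ᴹ matrixSum (labels Φ w)                ≡⟨ cong (_+ᴹ _) (arc⇒ arc) ⟩
    φ x +ᴹ A i +ᴹ matrixSum (labels Φ w)         ≡⟨ +ᴹ-assoc (φ x) (A i) _ ⟩
    φ x +ᴹ (A i +ᴹ matrixSum (labels Φ w))       ∎

  walk-sum : ∀ {x y M} (w : Walk (Joined Φ) x y) →
             φ y ≡ φ x +ᴹ M → matrixSum (labels Φ w) ≡ M
  walk-sum {x} w eq = +ᴹ-cancelˡ (φ x) (trans (sym (telescope w)) eq)

  distance⇐ : ∀ {x y M} → Walk (Joined Φ) x y → φ y ≡ φ x +ᴹ M →
              IsDistance Φ x y M
  distance⇐ w eq = w , λ w′ → walk-sum w′ eq

  distance⇒ : ∀ {x y M} → IsDistance Φ x y M → φ y ≡ φ x +ᴹ M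
  distance⇒ {x} (w , sums) = trans (telescope w) (cong (φ x +ᴹ_) (sums w))

  isDirectionGraph : IsDirectionGraph Φ
  isDirectionGraph = record
    { symmetric   = reverse
    ; uniqueLabel = λ {x} arc arc′ →
        A-injective (+ᴹ-cancelˡ (φ x) (trans (sym (arc⇒ arc)) (arc⇒ arc′)))
    ; cycleSum    = λ {x} w _ → walk-sum w (sym (+ᴹ-identityʳ (φ x)))
    }
    where
    reverse : ∀ {x y} → Joined Φ x y → Joined Φ y x
    reverse {x} {y} (i , arc) with j , Aj≡ ← opposite i = j , arc⇐ (begin
      φ x                    ≡⟨ +ᴹ-add-subtract (φ x) (A i) ⟩
      φ x +ᴹ A i +ᴹ -ᴹ A i   ≡⟨ cong₂ _+ᴹ_ (arc⇒ arc) Aj≡ ⟨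
      φ y +ᴹ A j             ∎)

  isCoherent : IsCoherent Φ
  isCoherent = record
    { zero-distance = λ {x} w → mk⇔
        (λ dist → injective (sym (trans (distance⇒ dist) (+ᴹ-identityʳ (φ x)))))
        (λ { refl → distance⇐ w (sym (+ᴹ-identityʳ (φ x))) })
    ; direction-distance = λ w → mk⇔
        (λ { (i , dist) → i , arc⇐ (distance⇒ dist) })
        (λ { (i , arc) → i , distance⇐ w (arc⇒ arc) })
    }

-- T is an additive injection of the matrices that induces the permutation
-- π on the direction matrices.
record Realizes (T : Matrix → Matrix) (π : Permutation) : Set where
  field
    additive    : ∀ X Y → T (X +ᴹ Y) ≡ T X +ᴹ T Y
    T-injective : ∀ {X Y} → T X ≡ T Y → X ≡ Y
    onA         : ∀ i → A (Inverse.to π i) ≡ T (A i)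

-- Relabeling the arcs by π amounts to transforming the potential by T.
relabel-potential : ∀ {Φ φ T π} → IsPotential Φ φ → Realizes T π →
                    IsPotential (relabel π Φ) (T ∘ φ)
relabel-potential {Φ} {φ} {T} {π} potential realizes = record
  { arc⇔      = λ x j y → mk⇔ forth (back {x} {j} {y})
  ; injective = injective ∘ T-injective
  }
  where
  open IsPotential potential
  open Realizes realizes
  open ≡-Reasoning

  shift : ∀ X i → T (X +ᴹ A i) ≡ T X +ᴹ A (Inverse.to π i)
  shift X i = trans (additive X (A i)) (cong (T X +ᴹ_) (sym (onA i)))

  forth : ∀ {x j y} → Arc (relabel π Φ) x j y → T (φ y) ≡ T (φ x) +ᴹ A j
  forth {x} (i , arc , refl) = trans (cong T (arc⇒ arc)) (shift (φ x) i)

  back : ∀ {x j y} → T (φ y) ≡ T (φ x) +ᴹ A j → Arc (relabel π Φ) x j y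
  back {x} {j} {y} eq = i , arc⇐ (T-injective (begin
    T (φ y)                       ≡⟨ eq ⟩
    T (φ x) +ᴹ A j                ≡⟨ cong (λ k → T (φ x) +ᴹ A k) πi≡j ⟨
    T (φ x) +ᴹ A (Inverse.to π i) ≡⟨ shift (φ x) i ⟨
    T (φ x +ᴹ A i)                ∎)) , πi≡j
    where
    i = Inverse.from π j
    πi≡j = Inverse.strictlyInverseˡ π j

relabel-joined : ∀ π Φ {x y} → Joined Φ x y ⇔ Joined (relabel π Φ) x y
relabel-joined π Φ = mk⇔ (λ { (i , arc) → Inverse.to π i , i , arc , refl })
                         (λ { (j , i , arc , eq) → i , arc })

-- A criterion for duality.

-- If φ a = ψ (η a) D + C for every a, then an arc of Φ′ labeled i, across
-- which ψ grows by A i, spans the distance A i D in Φ; the constant C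
-- cancels.
dual-from-potentials :
  ∀ {Φ Φ′ φ ψ} (D C : Matrix) →
  IsPotential Φ φ → IsPotential Φ′ ψ →
  IsConnected Φ → IsConnected Φ′ → UnderlyingIsomorphic Φ Φ′ →
  (η : Vertex Φ ↔ Vertex Φ′) → (∀ a → φ a ≡ ψ (Inverse.to η a) *ᴹ D +ᴹ C) →
  (∀ i → D ≢ A i) → IsDual Φ Φ′ D
dual-from-potentials {Φ} {Φ′} {φ} {ψ} D C φ-potential ψ-potential
  connected connected′ underlying η φ≡ψD+C D≢A = record
  { directionGraph  = Potential.isDirectionGraph φ-potential
  ; directionGraph′ = Potential.isDirectionGraph ψ-potential
  ; D-notDirection  = D≢A
  ; coherent        = Potential.isCoherent φ-potential
  ; coherent′       = Potential.isCoherent ψ-potential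
  ; connected       = connected
  ; connected′      = connected′
  ; underlying      = underlying
  ; η               = η
  ; distances       = λ a b i arc →
      Potential.distance⇐ φ-potential (connected a b) (difference a b i arc)
  }
  where
  open ≡-Reasoning
  to = Inverse.to η

  difference : ∀ a b i → Arc Φ′ (to a) i (to b) → φ b ≡ φ a +ᴹ A i *ᴹ D
  difference a b i arc = begin
    φ b                                        ≡⟨ φ≡ψD+C b ⟩
    ψ (to b) *ᴹ D +ᴹ C                         ≡⟨ cong (λ X → X *ᴹ D +ᴹ C) (IsPotential.arc⇒ ψ-potential arc) ⟩
    (ψ (to a) +ᴹ A i) *ᴹ D +ᴹ C                ≡⟨ cong (_+ᴹ C) (*ᴹ-distribʳ-+ᴹ D (ψ (to a)) (A i)) ⟩
    ψ (to a) *ᴹ D +ᴹ A i *ᴹ D +ᴹ C             ≡⟨ +ᴹ-assoc (ψ (to a) *ᴹ D) (A i *ᴹ D) C ⟩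
    ψ (to a) *ᴹ D +ᴹ (A i *ᴹ D +ᴹ C)           ≡⟨ cong (ψ (to a) *ᴹ D +ᴹ_) (+ᴹ-comm (A i *ᴹ D) C) ⟩
    ψ (to a) *ᴹ D +ᴹ (C +ᴹ A i *ᴹ D)           ≡⟨ +ᴹ-assoc (ψ (to a) *ᴹ D) C (A i *ᴹ D) ⟨
    ψ (to a) *ᴹ D +ᴹ C +ᴹ A i *ᴹ D             ≡⟨ cong (_+ᴹ A i *ᴹ D) (φ≡ψD+C a) ⟨
    φ a +ᴹ A i *ᴹ D                            ∎

-- Right multiplication by the matrix with rows (0, 1) and (-1, 0).
turn : Matrix → Matrix
turn (mat a b c d) = mat (ℤ.- b) a (ℤ.- d) c

-- Left multiplication by the diagonal matrix with entries 1 and -1.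
flip : Matrix → Matrix
flip (mat a b c d) = mat a b (ℤ.- c) (ℤ.- d)

turn-realizes : Realizes turn πPinwheel
turn-realizes = record
  { additive    = λ { (mat a b c d) (mat a′ b′ c′ d′) →
      mat-cong (ℤ.neg-distrib-+ b b′) refl (ℤ.neg-distrib-+ d d′) refl }
  ; T-injective = λ { {mat _ _ _ _} {mat _ _ _ _} eq →
      mat-cong (cong a₁₂ eq) (ℤ.neg-injective (cong a₁₁ eq))
               (cong a₂₂ eq) (ℤ.neg-injective (cong a₂₁ eq)) }
  ; onA = λ { d₁ → refl ; d₂ → refl ; d₃ → refl ; d₄ → refl
            ; d₅ → refl ; d₆ → refl ; d₇ → refl ; d₈ → refl }
  }
  where open Matrix

flip-realizes : Realizes flip πReflect
flip-realizes = record
  { additive    = λ { (mat a b c d) (mat a′ b′ c′ d′) →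
      mat-cong refl refl (ℤ.neg-distrib-+ c c′) (ℤ.neg-distrib-+ d d′) }
  ; T-injective = λ { {mat _ _ _ _} {mat _ _ _ _} eq →
      mat-cong (cong a₁₁ eq) (cong a₁₂ eq)
               (ℤ.neg-injective (cong a₂₁ eq)) (ℤ.neg-injective (cong a₂₂ eq)) }
  ; onA = λ { d₁ → refl ; d₂ → refl ; d₃ → refl ; d₄ → refl
            ; d₅ → refl ; d₆ → refl ; d₇ → refl ; d₈ → refl }
  }
  where open Matrix

πPinwheel-induced : IsInducedBy πPinwheel 1ᴹ πPinwheelMatrix
πPinwheel-induced d₁ = refl
πPinwheel-induced d₂ = refl
πPinwheel-induced d₃ = refl
πPinwheel-induced d₄ = refl
πPinwheel-induced d₅ = refl
πPinwheel-induced d₆ = refl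
πPinwheel-induced d₇ = refl
πPinwheel-induced d₈ = refl

-- The pinwheel graph.

-- The four rectangular boards whose union is a pinwheel board, in
-- counterclockwise order.
data Quadrant : Set where
  I II III IV : Quadrant

next prev : Quadrant → Quadrant
next I   = II
next II  = III
next III = IV
next IV  = I
prev I   = IV
prev II  = I
prev III = II
prev IV  = III

next-prev : ∀ r → next (prev r) ≡ r
next-prev I   = refl
next-prev II  = refl
next-prev III = refl
next-prev IV  = refl

-- The first board consists of the squares with doubled center
-- (p + q + 4kq, p - q + 4lq); its bounding rectangle becomes these four
-- inequalities on the indices k and l, in which p and q no longer occur.
record Box (N k l : ℤ) : Set where
  constructor box
  field
    sum≥0  : 0ℤ ℤ.≤ k ℤ.+ l
    sum≤N  : k ℤ.+ l ℤ.≤ N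
    diff≥  : 1ℤ ℤ.- N ℤ.≤ l ℤ.- k
    diff≤N : l ℤ.- k ℤ.≤ N

Box? : ∀ N k l → Dec (Box N k l)
Box? N k l = map′ (λ { (a , b , c , d) → box a b c d })
                  (λ { (box a b c d) → a , b , c , d })
  ((0ℤ ℤ.≤? k ℤ.+ l) ×-dec (k ℤ.+ l ℤ.≤? N) ×-dec
   (1ℤ ℤ.- N ℤ.≤? l ℤ.- k) ×-dec (l ℤ.- k ℤ.≤? N))

-- A square of a pinwheel board of order n, described without reference to
-- a leaper: the board that contains it, and its indices after that board
-- has been rotated back onto the first one.
record Cell (n : ℕ) : Set where
  constructor cell
  field
    quadrant : Quadrant
    k l      : ℤ
    .inside  : Box (+ n) k l

cell-cong : ∀ {n r k l k′ l′} .{b : Box (+ n) k l} .{b′ : Box (+ n) k′ l′} →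
            k ≡ k′ → l ≡ l′ → cell {n} r k l b ≡ cell r k′ l′ b′
cell-cong refl refl = refl

-- The matrix M for which the doubled center of the cell is
-- (p + q, p - q) + 2 M (p, q), for every leaper with parameters p and q.
-- Entries are kept in the shape constant plus or minus twice an index.
place : Quadrant → ℤ → ℤ → Matrix
place I   k l = mat 0ℤ  (0ℤ ℤ.+ + 2 ℤ.* k)
                    0ℤ  (0ℤ ℤ.+ + 2 ℤ.* l)
place II  k l = mat -1ℤ (0ℤ ℤ.- + 2 ℤ.* l)
                    0ℤ  (1ℤ ℤ.+ + 2 ℤ.* k)
place III k l = mat -1ℤ (-1ℤ ℤ.- + 2 ℤ.* k)
                    -1ℤ (1ℤ ℤ.- + 2 ℤ.* l)
place IV  k l = mat 0ℤ  (-1ℤ ℤ.+ + 2 ℤ.* l)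
                    -1ℤ (0ℤ ℤ.- + 2 ℤ.* k)

position : ∀ {n} → Cell n → Matrix
position (cell r k l _) = place r k l

position-injective : ∀ {n} {x y : Cell n} → position x ≡ position y → x ≡ y
position-injective {n} {cell r k l b} {cell r′ k′ l′ b′} = match r r′
  where
  open Matrix

  plus : ∀ c {i j} → c ℤ.+ + 2 ℤ.* i ≡ c ℤ.+ + 2 ℤ.* j → i ≡ j
  plus c {i} {j} eq = ℤ.*-cancelˡ-≡ (+ 2) i j (+-cancelˡ c (+ 2 ℤ.* i) (+ 2 ℤ.* j) eq)

  minus : ∀ c {i j} → c ℤ.- + 2 ℤ.* i ≡ c ℤ.- + 2 ℤ.* j → i ≡ j
  minus c {i} {j} eq = ℤ.*-cancelˡ-≡ (+ 2) i j
    (ℤ.neg-injective (+-cancelˡ c (ℤ.- (+ 2 ℤ.* i)) (ℤ.- (+ 2 ℤ.* j)) eq))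

  match : ∀ r r′ → place r k l ≡ place r′ k′ l′ → cell r k l b ≡ cell r′ k′ l′ b′
  match I   I   eq = cell-cong (plus 0ℤ (cong a₁₂ eq)) (plus 0ℤ (cong a₂₂ eq))
  match II  II  eq = cell-cong (plus 1ℤ (cong a₂₂ eq)) (minus 0ℤ (cong a₁₂ eq))
  match III III eq = cell-cong (minus -1ℤ (cong a₁₂ eq)) (minus 1ℤ (cong a₂₂ eq))
  match IV  IV  eq = cell-cong (minus 0ℤ (cong a₂₂ eq)) (plus -1ℤ (cong a₁₂ eq))
  match I   II  eq with () ← cong a₁₁ eq
  match I   III eq with () ← cong a₁₁ eq
  match I   IV  eq with () ← cong a₂₁ eq
  match II  I   eq with () ← cong a₁₁ eq
  match II  III eq with () ← cong a₂₁ eq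
  match II  IV  eq with () ← cong a₁₁ eq
  match III I   eq with () ← cong a₁₁ eq
  match III II  eq with () ← cong a₂₁ eq
  match III IV  eq with () ← cong a₁₁ eq
  match IV  I   eq with () ← cong a₂₁ eq
  match IV  II  eq with () ← cong a₁₁ eq
  match IV  III eq with () ← cong a₁₁ eq

-- A record rather than a bare equation, so that x and y can be inferred
-- from the type of an arc.
record PinwheelArc {n : ℕ} (x : Cell n) (i : Direction) (y : Cell n) : Set where
  constructor arc
  field
    shift : position y ≡ position x +ᴹ A i

pinwheel : ℕ → LabeledDigraph
pinwheel n = record { Vertex = Cell n ; Arc = PinwheelArc }

pinwheel-potential : ∀ n → IsPotential (pinwheel n) position
pinwheel-potential n = record
  { arc⇔      = λ _ _ _ → mk⇔ PinwheelArc.shift arc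
  ; injective = position-injective
  }

-- Connectedness of the pinwheel graph.

≤-from-difference : ∀ {i j i′ j′} → j ℤ.- i ≡ j′ ℤ.- i′ → i ℤ.≤ j → i′ ℤ.≤ j′
≤-from-difference eq i≤j =
  ℤ.0≤i-j⇒j≤i (subst (0ℤ ℤ.≤_) eq (ℤ.i≤j⇒0≤j-i i≤j))

module _ {n : ℕ} where

  open IsDirectionGraph (Potential.isDirectionGraph (pinwheel-potential n))
    using (symmetric)

  _~_ : Cell n → Cell n → Set
  _~_ = Joined (pinwheel n)

  private
    plus-shift : ∀ c d z → (c ℤ.+ d) ℤ.+ + 2 ℤ.* z ≡ c ℤ.+ + 2 ℤ.* z ℤ.+ d
    plus-shift = solve-∀
    minus-shift : ∀ c d z → (c ℤ.+ d) ℤ.- + 2 ℤ.* z ≡ c ℤ.- + 2 ℤ.* z ℤ.+ d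
    minus-shift = solve-∀
    plus-neg : ∀ c z → c ℤ.+ + 2 ℤ.* (ℤ.- z) ≡ c ℤ.- + 2 ℤ.* z ℤ.+ 0ℤ
    plus-neg = solve-∀
    minus-neg : ∀ c z → c ℤ.- + 2 ℤ.* (ℤ.- z) ≡ c ℤ.+ + 2 ℤ.* z ℤ.+ 0ℤ
    minus-neg = solve-∀
    plus-pred : ∀ c d z → (c ℤ.+ d ℤ.+ + 2) ℤ.+ + 2 ℤ.* (z ℤ.- 1ℤ) ≡
                          c ℤ.+ + 2 ℤ.* z ℤ.+ d
    plus-pred = solve-∀
    minus-pred : ∀ c d z → (c ℤ.+ d ℤ.- + 2) ℤ.- + 2 ℤ.* (z ℤ.- 1ℤ) ≡
                           c ℤ.- + 2 ℤ.* z ℤ.+ d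
    minus-pred = solve-∀

  -- In rotated indices, each cell has at most two neighbors in the next
  -- board and two in the previous one: from (k, l) the next board is
  -- entered at (l, -k) or (l - 1, -k), and the previous one at (-l, k) or
  -- (-l, k + 1).  The last possibility is not needed below.
  turn-forward : ∀ r k l → ∃[ i ] place (next r) l (ℤ.- k) ≡ place r k l +ᴹ A i
  turn-forward I   k l = d₃ , mat-cong refl (minus-neg 0ℤ k) refl (plus-shift 0ℤ 1ℤ l)
  turn-forward II  k l = d₅ , mat-cong refl (minus-shift 0ℤ -1ℤ l) refl (minus-neg 1ℤ k)
  turn-forward III k l = d₇ , mat-cong refl (plus-neg -1ℤ k) refl (minus-shift 1ℤ -1ℤ l)
  turn-forward IV  k l = d₁ , mat-cong refl (plus-shift -1ℤ 1ℤ l) refl (plus-neg 0ℤ k)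

  turn-inward : ∀ r k l → ∃[ i ] place (next r) (l ℤ.- 1ℤ) (ℤ.- k) ≡ place r k l +ᴹ A i
  turn-inward I   k l = d₆ , mat-cong refl (minus-neg 0ℤ k) refl (plus-pred 0ℤ -1ℤ l)
  turn-inward II  k l = d₈ , mat-cong refl (minus-pred 0ℤ 1ℤ l) refl (minus-neg 1ℤ k)
  turn-inward III k l = d₂ , mat-cong refl (plus-neg -1ℤ k) refl (minus-pred 1ℤ 1ℤ l)
  turn-inward IV  k l = d₄ , mat-cong refl (plus-pred -1ℤ -1ℤ l) refl (plus-neg 0ℤ k)

  turn-back : ∀ r k l → ∃[ i ] place r k l ≡ place (prev r) (ℤ.- l) k +ᴹ A i
  turn-back r k l =
    map₂ (trans (sym restored)) (turn-forward (prev r) (ℤ.- l) k)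
    where
    restored : place (next (prev r)) k (ℤ.- (ℤ.- l)) ≡ place r k l
    restored = cong₂ (λ r l → place r k l) (next-prev r) (ℤ.neg-involutive l)

  module _ (0<n : 0 ℕ.< n) where

    1≤N : 1ℤ ℤ.≤ + n
    1≤N = ℤ.+≤+ 0<n

    box-inward : ∀ {k l} → Box (+ n) k l → 1ℤ ℤ.≤ l ℤ.- k →
                 Box (+ n) (l ℤ.- 1ℤ) (ℤ.- k)
    box-inward {k} {l} (box s≥ s≤ d≥ d≤) 1≤d = box
      (≤-from-difference (e₁ k l) 1≤d)
      (≤-from-difference (e₂ k l (+ n)) (ℤ.+-mono-≤ d≤ 0≤1))
      (≤-from-difference (e₃ k l (+ n)) s≤)
      (≤-from-difference (e₄ k l (+ n)) (ℤ.+-mono-≤ s≥ 1≤N))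
      where
      0≤1 : 0ℤ ℤ.≤ 1ℤ
      0≤1 = ℤ.+≤+ ℕ.z≤n
      e₁ : ∀ k l → (l ℤ.- k) ℤ.- 1ℤ ≡ ((l ℤ.- 1ℤ) ℤ.+ ℤ.- k) ℤ.- 0ℤ
      e₁ = solve-∀
      e₂ : ∀ k l N → (N ℤ.+ 1ℤ) ℤ.- ((l ℤ.- k) ℤ.+ 0ℤ) ≡ N ℤ.- ((l ℤ.- 1ℤ) ℤ.+ ℤ.- k)
      e₂ = solve-∀
      e₃ : ∀ k l N → N ℤ.- (k ℤ.+ l) ≡ (ℤ.- k ℤ.- (l ℤ.- 1ℤ)) ℤ.- (1ℤ ℤ.- N)
      e₃ = solve-∀
      e₄ : ∀ k l N → (k ℤ.+ l ℤ.+ N) ℤ.- (0ℤ ℤ.+ 1ℤ) ≡ N ℤ.- (ℤ.- k ℤ.- (l ℤ.- 1ℤ))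
      e₄ = solve-∀

    box-back : ∀ {k l} → Box (+ n) k l → l ℤ.- k ℤ.≤ 0ℤ → Box (+ n) (ℤ.- l) k
    box-back {k} {l} (box s≥ s≤ d≥ d≤) d≤0 = box
      (≤-from-difference (e₁ k l) d≤0)
      (≤-from-difference (e₂ k l (+ n)) (ℤ.+-mono-≤ d≥ 0≤1))
      (≤-from-difference (e₃ k l (+ n)) (ℤ.+-mono-≤ s≥ 1≤N))
      (≤-from-difference (e₄ k l (+ n)) s≤)
      where
      0≤1 : 0ℤ ℤ.≤ 1ℤ
      0≤1 = ℤ.+≤+ ℕ.z≤n
      e₁ : ∀ k l → 0ℤ ℤ.- (l ℤ.- k) ≡ (ℤ.- l ℤ.+ k) ℤ.- 0ℤ
      e₁ = solve-∀
      e₂ : ∀ k l N → ((l ℤ.- k) ℤ.+ 1ℤ) ℤ.- ((1ℤ ℤ.- N) ℤ.+ 0ℤ) ≡ N ℤ.- (ℤ.- l ℤ.+ k)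
      e₂ = solve-∀
      e₃ : ∀ k l N → (k ℤ.+ l ℤ.+ N) ℤ.- (0ℤ ℤ.+ 1ℤ) ≡ (k ℤ.- ℤ.- l) ℤ.- (1ℤ ℤ.- N)
      e₃ = solve-∀
      e₄ : ∀ k l N → N ℤ.- (k ℤ.+ l) ≡ N ℤ.- (k ℤ.- ℤ.- l)
      e₄ = solve-∀

    -- The proof stored in a cell is irrelevant; membership is decidable, so a
    -- proof that can be computed with is recovered from it.
    inside! : (x : Cell n) → Box (+ n) (Cell.k x) (Cell.l x)
    inside! (cell _ k l b) = recompute (Box? (+ n) k l) b

    forward : ∀ r {k l} .{b : Box (+ n) k l} .{b′ : Box (+ n) l (ℤ.- k)} →
              cell r k l b ~ cell (next r) l (ℤ.- k) b′
    forward r {k} {l} = map₂ arc (turn-forward r k l)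

    inward : ∀ r {k l} (b : Box (+ n) k l) (1≤d : 1ℤ ℤ.≤ l ℤ.- k) →
             cell r k l b ~ cell (next r) (l ℤ.- 1ℤ) (ℤ.- k) (box-inward b 1≤d)
    inward r {k} {l} b 1≤d = map₂ arc (turn-inward r k l)

    back : ∀ r {k l} (b : Box (+ n) k l) (d≤0 : l ℤ.- k ℤ.≤ 0ℤ) →
           cell r k l b ~ cell (prev r) (ℤ.- l) k (box-back b d≤0)
    back r {k} {l} b d≤0 = symmetric (map₂ arc (turn-back r k l))

    size : Cell n → ℕ
    size (cell _ k l _) = ∣ k ∣ ℕ.+ ∣ l ∣

    -- Since l - k ≥ 1 and k + l ≥ 0 force l ≥ 1, passing to (l - 1, -k)
    -- lowers |k| + |l|.
    inward-smaller : ∀ {k l} → Box (+ n) k l → 1ℤ ℤ.≤ l ℤ.- k →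
                     ∣ l ℤ.- 1ℤ ∣ ℕ.+ ∣ ℤ.- k ∣ ℕ.< ∣ k ∣ ℕ.+ ∣ l ∣
    inward-smaller {k} {l} b 1≤d = smaller l
      (≤-from-difference (double k l) (ℤ.+-mono-≤ (Box.sum≥0 b) 1≤d))
      where
      double : ∀ k l → ((k ℤ.+ l) ℤ.+ (l ℤ.- k)) ℤ.- (0ℤ ℤ.+ 1ℤ) ≡ (l ℤ.+ l) ℤ.- 1ℤ
      double = solve-∀
      smaller : ∀ l → 1ℤ ℤ.≤ l ℤ.+ l → ∣ l ℤ.- 1ℤ ∣ ℕ.+ ∣ ℤ.- k ∣ ℕ.< ∣ k ∣ ℕ.+ ∣ l ∣
      smaller (+ zero) (ℤ.+≤+ ())
      smaller (+ suc m) _ = ℕ.≤-reflexive (begin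
        suc (m ℕ.+ ∣ ℤ.- k ∣)  ≡⟨ cong (λ z → suc (m ℕ.+ z)) (ℤ.∣-i∣≡∣i∣ k) ⟩
        suc (m ℕ.+ ∣ k ∣)      ≡⟨ cong suc (ℕ.+-comm m ∣ k ∣) ⟩
        suc (∣ k ∣ ℕ.+ m)      ≡⟨ ℕ.+-suc ∣ k ∣ m ⟨
        ∣ k ∣ ℕ.+ suc m        ∎)
        where open ≡-Reasoning

    back-size : ∀ k l → ∣ ℤ.- l ∣ ℕ.+ ∣ k ∣ ≡ ∣ k ∣ ℕ.+ ∣ l ∣
    back-size k l = trans (cong (ℕ._+ ∣ k ∣) (ℤ.∣-i∣≡∣i∣ l)) (ℕ.+-comm ∣ l ∣ ∣ k ∣)

    1≤⊎≤0 : ∀ z → 1ℤ ℤ.≤ z ⊎ z ℤ.≤ 0ℤ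
    1≤⊎≤0 (+ zero)  = inj₂ ℤ.≤-refl
    1≤⊎≤0 (+ suc m) = inj₁ (ℤ.+≤+ (ℕ.s≤s ℕ.z≤n))
    1≤⊎≤0 -[1+ m ]  = inj₂ ℤ.-≤+

    -- The hypotheses on l - k, k - (-l) and -l - (-k) say that the inward step
    -- fails at (k, l), at (-l, k) and at (-k, -l).
    origin-from-bounds : ∀ {k l} → 0ℤ ℤ.≤ k ℤ.+ l → l ℤ.- k ℤ.≤ 0ℤ →
                         k ℤ.- ℤ.- l ℤ.≤ 0ℤ → ℤ.- l ℤ.- ℤ.- k ℤ.≤ 0ℤ →
                         k ≡ 0ℤ × l ≡ 0ℤ
    origin-from-bounds {k} {l} s≥0 d≤0 s≤0 d≥0 = zero-if-double
      (≤-from-difference (e₁ k l) (ℤ.+-mono-≤ s≤0 d≥0))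
      (≤-from-difference (e₂ k l) (ℤ.+-mono-≤ d≤0 s≥0)) , zero-if-double
      (≤-from-difference (e₃ k l) (ℤ.+-mono-≤ d≤0 s≤0))
      (≤-from-difference (e₄ k l) (ℤ.+-mono-≤ d≥0 s≥0))
      where
      zero-if-double : ∀ {z} → + 2 ℤ.* z ℤ.≤ 0ℤ → 0ℤ ℤ.≤ + 2 ℤ.* z → z ≡ 0ℤ
      zero-if-double {z} ≤0 ≥0 = ℤ.*-cancelˡ-≡ (+ 2) z 0ℤ (ℤ.≤-antisym ≤0 ≥0)
      e₁ : ∀ k l → (0ℤ ℤ.+ 0ℤ) ℤ.- ((k ℤ.- ℤ.- l) ℤ.+ (ℤ.- l ℤ.- ℤ.- k)) ≡ 0ℤ ℤ.- (+ 2 ℤ.* k)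
      e₁ = solve-∀
      e₂ : ∀ k l → (0ℤ ℤ.+ (k ℤ.+ l)) ℤ.- ((l ℤ.- k) ℤ.+ 0ℤ) ≡ (+ 2 ℤ.* k) ℤ.- 0ℤ
      e₂ = solve-∀
      e₃ : ∀ k l → (0ℤ ℤ.+ 0ℤ) ℤ.- ((l ℤ.- k) ℤ.+ (k ℤ.- ℤ.- l)) ≡ 0ℤ ℤ.- (+ 2 ℤ.* l)
      e₃ = solve-∀
      e₄ : ∀ k l → (0ℤ ℤ.+ (k ℤ.+ l)) ℤ.- ((ℤ.- l ℤ.- ℤ.- k) ℤ.+ 0ℤ) ≡ (+ 2 ℤ.* l) ℤ.- 0ℤ
      e₄ = solve-∀

    Shrinks ReachesOrigin : Cell n → Set
    Shrinks x = ∃[ y ] (Walk _~_ x y × size y ℕ.< size x)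
    ReachesOrigin x = Σ[ r ∈ Quadrant ] Σ[ b ∈ Box (+ n) 0ℤ 0ℤ ]
                      Walk _~_ x (cell r 0ℤ 0ℤ b)

    is-origin : ∀ r {k l} → (b : Box (+ n) k l) → k ≡ 0ℤ × l ≡ 0ℤ →
                ReachesOrigin (cell r k l b)
    is-origin r b (refl , refl) = r , b , ε

    -- If the inward step is impossible, one step back rotates the cell by a
    -- right angle without changing its size; after at most two such steps
    -- the inward step becomes possible, unless k = l = 0.
    shrink-or-origin : ∀ r k l (b : Box (+ n) k l) →
                       let x = cell r k l b in Shrinks x ⊎ ReachesOrigin x
    shrink-or-origin r k l b with 1≤⊎≤0 (l ℤ.- k)
    ... | inj₁ 1≤d = inj₁ (_ , inward r b 1≤d ◅ ε , inward-smaller b 1≤d)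
    ... | inj₂ d≤0 with 1≤⊎≤0 (k ℤ.- ℤ.- l)
    ...   | inj₁ 1≤s = inj₁ (_ ,
              back r b d≤0 ◅ inward (prev r) b₁ 1≤s ◅ ε ,
              ℕ.<-≤-trans (inward-smaller b₁ 1≤s) (ℕ.≤-reflexive (back-size k l)))
      where b₁ = box-back b d≤0
    ...   | inj₂ s≤0 with 1≤⊎≤0 (ℤ.- l ℤ.- ℤ.- k)
    ...     | inj₁ 1≤d = inj₁ (_ ,
                back r b d≤0 ◅ back (prev r) b₁ s≤0 ◅ inward (prev (prev r)) b₂ 1≤d ◅ ε ,
                ℕ.<-≤-trans (inward-smaller b₂ 1≤d)
                  (ℕ.≤-reflexive (trans (back-size (ℤ.- l) k) (back-size k l))))
      where b₁ = box-back b d≤0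
            b₂ = box-back b₁ s≤0
    ...     | inj₂ d≥0 =
                inj₂ (is-origin r b (origin-from-bounds (Box.sum≥0 b) d≤0 s≤0 d≥0))

    -- Induction on the bound m for the size.
    reaches-origin : ∀ m (x : Cell n) → size x ℕ.≤ m → ReachesOrigin x
    reaches-origin m x@(cell r k l _) size≤m
      with shrink-or-origin r k l (inside! x)
    ... | inj₂ reached = reached
    reaches-origin zero x size≤0 | inj₁ (y , w , smaller)
      with () ← ℕ.<-≤-trans smaller size≤0
    reaches-origin (suc m) x size≤m | inj₁ (y , w , smaller)
      with r , b , w′ ← reaches-origin m y (ℕ.s≤s⁻¹ (ℕ.<-≤-trans smaller size≤m))
      = r , b , w ◅◅ w′

    pinwheel-connected : IsConnected (pinwheel n)
    pinwheel-connected x y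
      with r , b , w ← reaches-origin _ x ℕ.≤-refl
         | r′ , _ , w′ ← reaches-origin _ y ℕ.≤-refl
      = w ◅◅ Star.reverse symmetric (around r) ◅◅ around r′ ◅◅ Star.reverse symmetric w′
      where
      step : ∀ r → cell r 0ℤ 0ℤ b ~ cell (next r) 0ℤ 0ℤ b
      step r = forward r {0ℤ} {0ℤ}

      -- The four cells with k = l = 0 form a path.
      around : ∀ r → Walk _~_ (cell I 0ℤ 0ℤ b) (cell r 0ℤ 0ℤ b)
      around I   = ε
      around II  = step I ◅ ε
      around III = step I ◅ step II ◅ ε
      around IV  = step I ◅ step II ◅ step III ◅ ε

-- Duality of the pinwheel graph.

involution : ∀ {V : Set} (f : V → V) → (∀ x → f (f x) ≡ x) → V ↔ V
involution f f∘f≡id = mk↔ₛ′ f f f∘f≡id f∘f≡id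

relabel-connected : ∀ π {Φ} → IsConnected Φ → IsConnected (relabel π Φ)
relabel-connected π {Φ} connected x y =
  Star.map (Equivalence.to (relabel-joined π Φ)) (connected x y)

private
  minus-minus : ∀ M k → M ℤ.- (M ℤ.- k) ≡ k
  minus-minus = solve-∀
  minus-minus′ : ∀ M l → M ℤ.+ 1ℤ ℤ.- (M ℤ.+ 1ℤ ℤ.- l) ≡ l
  minus-minus′ = solve-∀

A-pinwheel-not-direction : ∀ {n} → 0 ℕ.< n → ∀ i → A-pinwheel n ≢ A i
A-pinwheel-not-direction {suc n} _ d₁ eq with () ← cong Matrix.a₂₂ eq
A-pinwheel-not-direction _ d₂ eq with () ← cong Matrix.a₁₁ eq
A-pinwheel-not-direction _ d₃ eq with () ← cong Matrix.a₁₁ eq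
A-pinwheel-not-direction _ d₄ eq with () ← cong Matrix.a₁₂ eq
A-pinwheel-not-direction _ d₅ eq with () ← cong Matrix.a₁₂ eq
A-pinwheel-not-direction _ d₆ eq with () ← cong Matrix.a₁₁ eq
A-pinwheel-not-direction _ d₇ eq with () ← cong Matrix.a₁₁ eq
A-pinwheel-not-direction _ d₈ eq with () ← cong Matrix.a₂₁ eq

-- The half-turn of the box onto itself, for N = 2M + 1.
reflect-box : ∀ {N k l} M → N ≡ 1ℤ ℤ.+ + 2 ℤ.* M → Box N k l →
              Box N (M ℤ.- k) (M ℤ.+ 1ℤ ℤ.- l)
reflect-box {k = k} {l = l} M refl (box s≥ s≤ d≥ d≤) = box
  (≤-from-difference (e₁ M k l) s≤)
  (≤-from-difference (e₂ M k l) s≥)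
  (≤-from-difference (e₃ M k l) d≤)
  (≤-from-difference (e₄ M k l) d≥)
  where
  e₁ : ∀ M k l → (1ℤ ℤ.+ + 2 ℤ.* M) ℤ.- (k ℤ.+ l) ≡
                 (M ℤ.- k ℤ.+ (M ℤ.+ 1ℤ ℤ.- l)) ℤ.- 0ℤ
  e₁ = solve-∀
  e₂ : ∀ M k l → (k ℤ.+ l) ℤ.- 0ℤ ≡
                 (1ℤ ℤ.+ + 2 ℤ.* M) ℤ.- (M ℤ.- k ℤ.+ (M ℤ.+ 1ℤ ℤ.- l))
  e₂ = solve-∀
  e₃ : ∀ M k l → (1ℤ ℤ.+ + 2 ℤ.* M) ℤ.- (l ℤ.- k) ≡
                 (M ℤ.+ 1ℤ ℤ.- l ℤ.- (M ℤ.- k)) ℤ.- (1ℤ ℤ.- (1ℤ ℤ.+ + 2 ℤ.* M))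
  e₃ = solve-∀
  e₄ : ∀ M k l → (l ℤ.- k) ℤ.- (1ℤ ℤ.- (1ℤ ℤ.+ + 2 ℤ.* M)) ≡
                 (1ℤ ℤ.+ + 2 ℤ.* M) ℤ.- (M ℤ.+ 1ℤ ℤ.- l ℤ.- (M ℤ.- k))
  e₄ = solve-∀

-- For n = 2M + 1, the duality map turns each of the four boards by a
-- half-turn about its center.
module Odd {n : ℕ} (M : ℤ) (N≡1+2M : + n ≡ 1ℤ ℤ.+ + 2 ℤ.* M) where

  η : Cell n → Cell n
  η (cell r k l b) = cell r (M ℤ.- k) (M ℤ.+ 1ℤ ℤ.- l) (reflect-box M N≡1+2M b)

  η-involutive : ∀ x → η (η x) ≡ x
  η-involutive (cell r k l b) = cell-cong (minus-minus M k) (minus-minus′ M l)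

  constant : Matrix
  constant = mat 0ℤ (+ 2 ℤ.* M) 0ℤ (+ 2 ℤ.* M ℤ.+ + 2)

  -- The lemma second-rj treats the entry in row j and column 2 for board r.
  private
    first : ∀ z a → a ≡ z ℤ.* 0ℤ ℤ.+ a ℤ.* 1ℤ ℤ.+ 0ℤ
    first = solve-∀

    second-I1 : ∀ M k → 0ℤ ℤ.+ + 2 ℤ.* k ≡
      (ℤ.- (0ℤ ℤ.+ + 2 ℤ.* (M ℤ.- k))) ℤ.* 1ℤ
      ℤ.+ 0ℤ ℤ.* (+ 2 ℤ.* (1ℤ ℤ.+ + 2 ℤ.* M)) ℤ.+ + 2 ℤ.* M
    second-I1 = solve-∀

    second-I2 : ∀ M l → 0ℤ ℤ.+ + 2 ℤ.* l ≡
      (ℤ.- (0ℤ ℤ.+ + 2 ℤ.* (M ℤ.+ 1ℤ ℤ.- l))) ℤ.* 1ℤ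
      ℤ.+ 0ℤ ℤ.* (+ 2 ℤ.* (1ℤ ℤ.+ + 2 ℤ.* M)) ℤ.+ (+ 2 ℤ.* M ℤ.+ + 2)
    second-I2 = solve-∀

    second-II1 : ∀ M l → 0ℤ ℤ.- + 2 ℤ.* l ≡
      (ℤ.- (0ℤ ℤ.- + 2 ℤ.* (M ℤ.+ 1ℤ ℤ.- l))) ℤ.* 1ℤ
      ℤ.+ -1ℤ ℤ.* (+ 2 ℤ.* (1ℤ ℤ.+ + 2 ℤ.* M)) ℤ.+ + 2 ℤ.* M
    second-II1 = solve-∀

    second-II2 : ∀ M k → 1ℤ ℤ.+ + 2 ℤ.* k ≡
      (ℤ.- (1ℤ ℤ.+ + 2 ℤ.* (M ℤ.- k))) ℤ.* 1ℤ
      ℤ.+ 0ℤ ℤ.* (+ 2 ℤ.* (1ℤ ℤ.+ + 2 ℤ.* M)) ℤ.+ (+ 2 ℤ.* M ℤ.+ + 2)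
    second-II2 = solve-∀

    second-III1 : ∀ M k → -1ℤ ℤ.- + 2 ℤ.* k ≡
      (ℤ.- (-1ℤ ℤ.- + 2 ℤ.* (M ℤ.- k))) ℤ.* 1ℤ
      ℤ.+ -1ℤ ℤ.* (+ 2 ℤ.* (1ℤ ℤ.+ + 2 ℤ.* M)) ℤ.+ + 2 ℤ.* M
    second-III1 = solve-∀

    second-III2 : ∀ M l → 1ℤ ℤ.- + 2 ℤ.* l ≡
      (ℤ.- (1ℤ ℤ.- + 2 ℤ.* (M ℤ.+ 1ℤ ℤ.- l))) ℤ.* 1ℤ
      ℤ.+ -1ℤ ℤ.* (+ 2 ℤ.* (1ℤ ℤ.+ + 2 ℤ.* M)) ℤ.+ (+ 2 ℤ.* M ℤ.+ + 2)
    second-III2 = solve-∀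

    second-IV1 : ∀ M l → -1ℤ ℤ.+ + 2 ℤ.* l ≡
      (ℤ.- (-1ℤ ℤ.+ + 2 ℤ.* (M ℤ.+ 1ℤ ℤ.- l))) ℤ.* 1ℤ
      ℤ.+ 0ℤ ℤ.* (+ 2 ℤ.* (1ℤ ℤ.+ + 2 ℤ.* M)) ℤ.+ + 2 ℤ.* M
    second-IV1 = solve-∀

    second-IV2 : ∀ M k → 0ℤ ℤ.- + 2 ℤ.* k ≡
      (ℤ.- (0ℤ ℤ.- + 2 ℤ.* (M ℤ.- k))) ℤ.* 1ℤ
      ℤ.+ -1ℤ ℤ.* (+ 2 ℤ.* (1ℤ ℤ.+ + 2 ℤ.* M)) ℤ.+ (+ 2 ℤ.* M ℤ.+ + 2)
    second-IV2 = solve-∀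

  -- The entries are affine in M, k and l; the constant matrix is the one
  -- that makes all four boards agree.
  position-η : ∀ r k l →
    place r k l ≡ turn (place r (M ℤ.- k) (M ℤ.+ 1ℤ ℤ.- l))
                  *ᴹ mat 0ℤ 1ℤ 1ℤ (+ 2 ℤ.* (1ℤ ℤ.+ + 2 ℤ.* M)) +ᴹ constant
  position-η I k l = mat-cong
    (first (ℤ.- (0ℤ ℤ.+ + 2 ℤ.* (M ℤ.- k))) 0ℤ)
    (second-I1 M k)
    (first (ℤ.- (0ℤ ℤ.+ + 2 ℤ.* (M ℤ.+ 1ℤ ℤ.- l))) 0ℤ)
    (second-I2 M l)
  position-η II k l = mat-cong
    (first (ℤ.- (0ℤ ℤ.- + 2 ℤ.* (M ℤ.+ 1ℤ ℤ.- l))) -1ℤ)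
    (second-II1 M l)
    (first (ℤ.- (1ℤ ℤ.+ + 2 ℤ.* (M ℤ.- k))) 0ℤ)
    (second-II2 M k)
  position-η III k l = mat-cong
    (first (ℤ.- (-1ℤ ℤ.- + 2 ℤ.* (M ℤ.- k))) -1ℤ)
    (second-III1 M k)
    (first (ℤ.- (1ℤ ℤ.- + 2 ℤ.* (M ℤ.+ 1ℤ ℤ.- l))) -1ℤ)
    (second-III2 M l)
  position-η IV k l = mat-cong
    (first (ℤ.- (-1ℤ ℤ.+ + 2 ℤ.* (M ℤ.+ 1ℤ ℤ.- l))) 0ℤ)
    (second-IV1 M l)
    (first (ℤ.- (0ℤ ℤ.- + 2 ℤ.* (M ℤ.- k))) -1ℤ)
    (second-IV2 M k)

odd-dual : ∀ {n} → 0 ℕ.< n → ¬ 2 ∣ n →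
           IsDual (pinwheel n) (relabel πPinwheel (pinwheel n)) (A-pinwheel n)
odd-dual {n} 0<n 2∤n = dual-from-potentials (A-pinwheel n) constant
  (pinwheel-potential n) (relabel-potential (pinwheel-potential n) turn-realizes)
  (pinwheel-connected 0<n) (relabel-connected πPinwheel (pinwheel-connected 0<n))
  (↔-id _ , λ _ _ → relabel-joined πPinwheel (pinwheel n))
  (involution η η-involutive)
  (λ { (cell r k l _) → subst
    (λ N → place r k l ≡ turn (place r (M ℤ.- k) (M ℤ.+ 1ℤ ℤ.- l)) *ᴹ mat 0ℤ 1ℤ 1ℤ (+ 2 ℤ.* N) +ᴹ constant)
    (sym N≡1+2M) (position-η r k l) })
  (A-pinwheel-not-direction 0<n)
  where
  M : ℤ
  M = + (n / 2)

  n%2≡1 : n % 2 ≡ 1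
  n%2≡1 with n % 2 in eq | m%n<n n 2
  ... | 0 | _ = ⊥-elim (2∤n (m%n≡0⇒n∣m n 2 eq))
  ... | 1 | _ = refl
  ... | suc (suc _) | ℕ.s≤s (ℕ.s≤s ())

  N≡1+2M : + n ≡ 1ℤ ℤ.+ + 2 ℤ.* M
  N≡1+2M = begin
    + n                          ≡⟨ cong +_ (m≡m%n+[m/n]*n n 2) ⟩
    + (n % 2 ℕ.+ n / 2 ℕ.* 2)    ≡⟨ cong (λ z → + (z ℕ.+ n / 2 ℕ.* 2)) n%2≡1 ⟩
    1ℤ ℤ.+ + (n / 2 ℕ.* 2)       ≡⟨ cong (λ z → 1ℤ ℤ.+ z) (trans (ℤ.pos-* (n / 2) 2) (ℤ.*-comm M (+ 2))) ⟩
    1ℤ ℤ.+ + 2 ℤ.* M             ∎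
    where open ≡-Reasoning

  open Odd M N≡1+2M

-- The exchange of boards under which the upper entry of the first column
-- of a position is kept and the lower one changes, as the quadrants of the
-- plane are exchanged by a reflection in the horizontal axis.
mirror : Quadrant → Quadrant
mirror I   = IV
mirror II  = III
mirror III = II
mirror IV  = I

mirror-involutive : ∀ r → mirror (mirror r) ≡ r
mirror-involutive I   = refl
mirror-involutive II  = refl
mirror-involutive III = refl
mirror-involutive IV  = refl

-- The reflection of the box across its line k + l = M, for N = 2M.
mirror-box : ∀ {N k l} M → N ≡ + 2 ℤ.* M → Box N k l →
             Box N (M ℤ.- l) (M ℤ.- k)
mirror-box {k = k} {l = l} M refl (box s≥ s≤ d≥ d≤) = box
  (≤-from-difference (e₁ M k l) s≤)
  (≤-from-difference (e₂ M k l) s≥)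
  (subst (_ ℤ.≤_) (e₃ M k l) d≥)
  (subst (ℤ._≤ _) (e₃ M k l) d≤)
  where
  e₁ : ∀ M k l → + 2 ℤ.* M ℤ.- (k ℤ.+ l) ≡ (M ℤ.- l ℤ.+ (M ℤ.- k)) ℤ.- 0ℤ
  e₁ = solve-∀
  e₂ : ∀ M k l → (k ℤ.+ l) ℤ.- 0ℤ ≡ + 2 ℤ.* M ℤ.- (M ℤ.- l ℤ.+ (M ℤ.- k))
  e₂ = solve-∀
  e₃ : ∀ M k l → l ℤ.- k ≡ M ℤ.- k ℤ.- (M ℤ.- l)
  e₃ = solve-∀

-- For n = 2M, the duality map exchanges the first board with the fourth
-- and the second with the third.
module Even {n : ℕ} (M : ℤ) (N≡2M : + n ≡ + 2 ℤ.* M) where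

  η : Cell n → Cell n
  η (cell r k l b) = cell (mirror r) (M ℤ.- l) (M ℤ.- k) (mirror-box M N≡2M b)

  η-involutive : ∀ x → η (η x) ≡ x
  η-involutive (cell r k l b) rewrite mirror-involutive r =
    cell-cong (minus-minus M k) (minus-minus M l)

  constant : Matrix
  constant = mat 0ℤ (+ 2 ℤ.* M ℤ.- 1ℤ) -1ℤ (ℤ.- (+ 2 ℤ.* M))

  -- The lemma second-rj treats the entry in row j and column 2 for board r.
  private
    first : ∀ z a → a ≡ z ℤ.* 0ℤ ℤ.+ a ℤ.* 1ℤ ℤ.+ 0ℤ
    first = solve-∀

    first′ : ∀ z a → a ≡ z ℤ.* 0ℤ ℤ.+ (a ℤ.+ 1ℤ) ℤ.* 1ℤ ℤ.+ -1ℤ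
    first′ = solve-∀

    second-I1 : ∀ M k → 0ℤ ℤ.+ + 2 ℤ.* k ≡
      (ℤ.- (-1ℤ ℤ.+ + 2 ℤ.* (M ℤ.- k))) ℤ.* 1ℤ
      ℤ.+ 0ℤ ℤ.* (+ 2 ℤ.* (+ 2 ℤ.* M)) ℤ.+ (+ 2 ℤ.* M ℤ.- 1ℤ)
    second-I1 = solve-∀

    second-I2 : ∀ M l → 0ℤ ℤ.+ + 2 ℤ.* l ≡
      (ℤ.- (ℤ.- (0ℤ ℤ.- + 2 ℤ.* (M ℤ.- l)))) ℤ.* 1ℤ
      ℤ.+ 1ℤ ℤ.* (+ 2 ℤ.* (+ 2 ℤ.* M)) ℤ.+ (ℤ.- (+ 2 ℤ.* M))
    second-I2 = solve-∀

    second-II1 : ∀ M l → 0ℤ ℤ.- + 2 ℤ.* l ≡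
      (ℤ.- (-1ℤ ℤ.- + 2 ℤ.* (M ℤ.- l))) ℤ.* 1ℤ
      ℤ.+ -1ℤ ℤ.* (+ 2 ℤ.* (+ 2 ℤ.* M)) ℤ.+ (+ 2 ℤ.* M ℤ.- 1ℤ)
    second-II1 = solve-∀

    second-II2 : ∀ M k → 1ℤ ℤ.+ + 2 ℤ.* k ≡
      (ℤ.- (ℤ.- (1ℤ ℤ.- + 2 ℤ.* (M ℤ.- k)))) ℤ.* 1ℤ
      ℤ.+ 1ℤ ℤ.* (+ 2 ℤ.* (+ 2 ℤ.* M)) ℤ.+ (ℤ.- (+ 2 ℤ.* M))
    second-II2 = solve-∀

    second-III1 : ∀ M k → -1ℤ ℤ.- + 2 ℤ.* k ≡
      (ℤ.- (0ℤ ℤ.- + 2 ℤ.* (M ℤ.- k))) ℤ.* 1ℤ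
      ℤ.+ -1ℤ ℤ.* (+ 2 ℤ.* (+ 2 ℤ.* M)) ℤ.+ (+ 2 ℤ.* M ℤ.- 1ℤ)
    second-III1 = solve-∀

    second-III2 : ∀ M l → 1ℤ ℤ.- + 2 ℤ.* l ≡
      (ℤ.- (ℤ.- (1ℤ ℤ.+ + 2 ℤ.* (M ℤ.- l)))) ℤ.* 1ℤ
      ℤ.+ 0ℤ ℤ.* (+ 2 ℤ.* (+ 2 ℤ.* M)) ℤ.+ (ℤ.- (+ 2 ℤ.* M))
    second-III2 = solve-∀

    second-IV1 : ∀ M l → -1ℤ ℤ.+ + 2 ℤ.* l ≡
      (ℤ.- (0ℤ ℤ.+ + 2 ℤ.* (M ℤ.- l))) ℤ.* 1ℤ
      ℤ.+ 0ℤ ℤ.* (+ 2 ℤ.* (+ 2 ℤ.* M)) ℤ.+ (+ 2 ℤ.* M ℤ.- 1ℤ)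
    second-IV1 = solve-∀

    second-IV2 : ∀ M k → 0ℤ ℤ.- + 2 ℤ.* k ≡
      (ℤ.- (ℤ.- (0ℤ ℤ.+ + 2 ℤ.* (M ℤ.- k)))) ℤ.* 1ℤ
      ℤ.+ 0ℤ ℤ.* (+ 2 ℤ.* (+ 2 ℤ.* M)) ℤ.+ (ℤ.- (+ 2 ℤ.* M))
    second-IV2 = solve-∀

  -- The entries are affine in M, k and l; the constant matrix is the one
  -- that makes all four boards agree.
  position-η : ∀ r k l →
    place r k l ≡ flip (turn (place (mirror r) (M ℤ.- l) (M ℤ.- k)))
                  *ᴹ mat 0ℤ 1ℤ 1ℤ (+ 2 ℤ.* (+ 2 ℤ.* M)) +ᴹ constant
  position-η I k l = mat-cong
    (first (ℤ.- (-1ℤ ℤ.+ + 2 ℤ.* (M ℤ.- k))) 0ℤ)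
    (second-I1 M k)
    (first′ (ℤ.- (ℤ.- (0ℤ ℤ.- + 2 ℤ.* (M ℤ.- l)))) 0ℤ)
    (second-I2 M l)
  position-η II k l = mat-cong
    (first (ℤ.- (-1ℤ ℤ.- + 2 ℤ.* (M ℤ.- l))) -1ℤ)
    (second-II1 M l)
    (first′ (ℤ.- (ℤ.- (1ℤ ℤ.- + 2 ℤ.* (M ℤ.- k)))) 0ℤ)
    (second-II2 M k)
  position-η III k l = mat-cong
    (first (ℤ.- (0ℤ ℤ.- + 2 ℤ.* (M ℤ.- k))) -1ℤ)
    (second-III1 M k)
    (first′ (ℤ.- (ℤ.- (1ℤ ℤ.+ + 2 ℤ.* (M ℤ.- l)))) -1ℤ)
    (second-III2 M l)
  position-η IV k l = mat-cong
    (first (ℤ.- (0ℤ ℤ.+ + 2 ℤ.* (M ℤ.- l))) 0ℤ)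
    (second-IV1 M l)
    (first′ (ℤ.- (ℤ.- (0ℤ ℤ.+ + 2 ℤ.* (M ℤ.- k)))) -1ℤ)
    (second-IV2 M k)

even-dual : ∀ {n} → 0 ℕ.< n → 2 ∣ n →
            IsDual (pinwheel n) (relabel πReflect (relabel πPinwheel (pinwheel n))) (A-pinwheel n)
even-dual {n} 0<n (divides m n≡m*2) = dual-from-potentials (A-pinwheel n) constant
  (pinwheel-potential n)
  (relabel-potential (relabel-potential (pinwheel-potential n) turn-realizes) flip-realizes)
  (pinwheel-connected 0<n)
  (relabel-connected πReflect (relabel-connected πPinwheel (pinwheel-connected 0<n)))
  (↔-id _ , λ _ _ → relabel-joined πReflect (relabel πPinwheel (pinwheel n))
                    ⇔-∘ relabel-joined πPinwheel (pinwheel n))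
  (involution η η-involutive)
  (λ { (cell r k l _) → subst
    (λ N → place r k l ≡ flip (turn (place (mirror r) (M ℤ.- l) (M ℤ.- k))) *ᴹ mat 0ℤ 1ℤ 1ℤ (+ 2 ℤ.* N) +ᴹ constant)
    (sym N≡2M) (position-η r k l) })
  (A-pinwheel-not-direction 0<n)
  where
  M : ℤ
  M = + m

  N≡2M : + n ≡ + 2 ℤ.* M
  N≡2M = trans (cong +_ n≡m*2) (trans (ℤ.pos-* m 2) (ℤ.*-comm M (+ 2)))

  open Even M N≡2M

-- A matrix of the relevant kind is determined by its value at (p, q).

double-too-big : ∀ {p q f} → p ℕ.< q → 2 ℕ.* p ≢ suc (suc f) ℕ.* q
double-too-big {p} {q} {f} p<q eq = ℕ.<-irrefl eq (ℕ.<-≤-trans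
  (ℕ.*-monoʳ-< 2 p<q) (ℕ.*-monoˡ-≤ q (ℕ.s≤s (ℕ.s≤s (ℕ.z≤n {f})))))

-- In the next two lemmas e and f are the absolute values of the entries of
-- a row that annihilates (p, q).  As 0 < p < q, such a row with e ≤ 2 is
-- zero or has e = 2 and f = 1.
row-even : ∀ {p q e f} → 0 ℕ.< p → p ℕ.< q → e ℕ.≤ 2 → e ℕ.* p ≡ f ℕ.* q → 2 ∣ e
row-even {e = 0} 0<p p<q e≤2 eq = 2 ∣0
row-even {p} {q} {1} {zero} 0<p p<q e≤2 eq =
  contradiction (trans (sym eq) (ℕ.*-identityˡ p)) (ℕ.<⇒≢ 0<p)
row-even {p} {q} {1} {suc f} 0<p p<q e≤2 eq =
  contradiction (trans (sym (ℕ.*-identityˡ p)) eq)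
                (ℕ.<⇒≢ (ℕ.<-≤-trans p<q (ℕ.m≤m+n q (f ℕ.* q))))
row-even {e = 2} 0<p p<q e≤2 eq = divides 1 refl
row-even {e = suc (suc (suc _))} 0<p p<q (ℕ.s≤s (ℕ.s≤s ())) eq

row-zero : ∀ {p q e f} → 0 ℕ.< p → p ℕ.< q → e ℕ.≤ 2 → 2 ∣ e → 2 ∣ f →
           e ℕ.* p ≡ f ℕ.* q → e ≡ 0 × f ≡ 0
row-zero {q = q} {0} {zero} 0<p p<q e≤2 2∣e 2∣f eq = refl , refl
row-zero {q = suc q} {0} {suc f} 0<p p<q e≤2 2∣e 2∣f ()
row-zero {e = 1} 0<p p<q e≤2 2∣e 2∣f eq with ℕ.s≤s () ← ∣⇒≤ 2∣e
row-zero {p = suc p} {e = 2} {0} 0<p p<q e≤2 2∣e 2∣f ()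
row-zero {e = 2} {1} 0<p p<q e≤2 2∣e 2∣f eq with ℕ.s≤s () ← ∣⇒≤ 2∣f
row-zero {e = 2} {suc (suc f)} 0<p p<q e≤2 2∣e 2∣f eq =
  contradiction eq (double-too-big {f = f} p<q)
row-zero {e = suc (suc (suc _))} 0<p p<q (ℕ.s≤s (ℕ.s≤s ())) 2∣e 2∣f eq

open Matrix

-- The matrix is congruent modulo 2 to one with equal diagonal entries and
-- equal antidiagonal entries.
record Checkered (M : Matrix) : Set where
  constructor _,_
  field
    diagonal     : + 2 ℤ.∣ a₁₁ M ℤ.+ a₂₂ M
    antidiagonal : + 2 ℤ.∣ a₁₂ M ℤ.+ a₂₁ M

checkered-+ : ∀ {X Y} → Checkered X → Checkered Y → Checkered (X +ᴹ Y)
checkered-+ {mat a b c d} {mat a′ b′ c′ d′} (x , x′) (y , y′) =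
  subst (+ 2 ℤ.∣_) (interchange a d a′ d′) (ℤ.∣m∣n⇒∣m+n x y) ,
  subst (+ 2 ℤ.∣_) (interchange b c b′ c′) (ℤ.∣m∣n⇒∣m+n x′ y′)
  where
  interchange : ∀ a d a′ d′ → (a ℤ.+ d) ℤ.+ (a′ ℤ.+ d′) ≡ (a ℤ.+ a′) ℤ.+ (d ℤ.+ d′)
  interchange = solve-∀

place-checkered : ∀ r k l → Checkered (place r k l)
place-checkered I k l = ℤ.divides l (e l) , ℤ.divides k (e′ k)
  where
  e : ∀ l → 0ℤ ℤ.+ (0ℤ ℤ.+ + 2 ℤ.* l) ≡ l ℤ.* + 2
  e = solve-∀
  e′ : ∀ l → (0ℤ ℤ.+ + 2 ℤ.* l) ℤ.+ 0ℤ ≡ l ℤ.* + 2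
  e′ = solve-∀
place-checkered II k l = ℤ.divides k (e k) , ℤ.divides (ℤ.- l) (e′ l)
  where
  e : ∀ k → -1ℤ ℤ.+ (1ℤ ℤ.+ + 2 ℤ.* k) ≡ k ℤ.* + 2
  e = solve-∀
  e′ : ∀ l → (0ℤ ℤ.- + 2 ℤ.* l) ℤ.+ 0ℤ ≡ (ℤ.- l) ℤ.* + 2
  e′ = solve-∀
place-checkered III k l = ℤ.divides (ℤ.- l) (e l) , ℤ.divides (-1ℤ ℤ.- k) (e′ k)
  where
  e : ∀ l → -1ℤ ℤ.+ (1ℤ ℤ.- + 2 ℤ.* l) ≡ (ℤ.- l) ℤ.* + 2
  e = solve-∀
  e′ : ∀ k → (-1ℤ ℤ.- + 2 ℤ.* k) ℤ.+ -1ℤ ≡ (-1ℤ ℤ.- k) ℤ.* + 2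
  e′ = solve-∀
place-checkered IV k l = ℤ.divides (ℤ.- k) (e k) , ℤ.divides (l ℤ.- 1ℤ) (e′ l)
  where
  e : ∀ k → 0ℤ ℤ.+ (0ℤ ℤ.- + 2 ℤ.* k) ≡ (ℤ.- k) ℤ.* + 2
  e = solve-∀
  e′ : ∀ l → (-1ℤ ℤ.+ + 2 ℤ.* l) ℤ.+ -1ℤ ≡ (l ℤ.- 1ℤ) ℤ.* + 2
  e′ = solve-∀

-- In X - Z both entries of the first column are even by row-even.  Being
-- checkered, X - Z then has only even entries, and row-zero applies to
-- both rows.
agree : ∀ {p q X Z} → 0 ℕ.< p → p ℕ.< q → Checkered X → Checkered Z →
        ∣ a₁₁ X ℤ.- a₁₁ Z ∣ ℕ.≤ 2 → ∣ a₂₁ X ℤ.- a₂₁ Z ∣ ℕ.≤ 2 →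
        X · (+ p , + q) ≡ Z · (+ p , + q) → X ≡ Z
agree {p} {q} {mat a b c d} {mat a′ b′ c′ d′} 0<p p<q (x , x′) (z , z′) ≤2 ≤2′ eq =
  mat-cong (equal (proj₁ row₁)) (equal (proj₂ row₁))
           (equal (proj₁ row₂)) (equal (proj₂ row₂))
  where
  equal : ∀ {i j} → ∣ i ℤ.- j ∣ ≡ 0 → i ≡ j
  equal {i} {j} eq = ℤ.i-j≡0⇒i≡j i j (ℤ.∣i∣≡0⇒i≡0 eq)

  row : ∀ a a′ b b′ → a ℤ.* + p ℤ.+ b ℤ.* + q ≡ a′ ℤ.* + p ℤ.+ b′ ℤ.* + q →
        ∣ a ℤ.- a′ ∣ ℕ.* p ≡ ∣ b ℤ.- b′ ∣ ℕ.* q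
  row a a′ b b′ eq = begin
    ∣ a ℤ.- a′ ∣ ℕ.* p            ≡⟨ ℤ.abs-* (a ℤ.- a′) (+ p) ⟨
    ∣ (a ℤ.- a′) ℤ.* + p ∣        ≡⟨ cong ∣_∣ (begin
      (a ℤ.- a′) ℤ.* + p                                           ≡⟨ before a a′ b (+ p) (+ q) ⟩
      (a ℤ.* + p ℤ.+ b ℤ.* + q) ℤ.- (a′ ℤ.* + p ℤ.+ b ℤ.* + q)     ≡⟨ cong (ℤ._- _) eq ⟩
      (a′ ℤ.* + p ℤ.+ b′ ℤ.* + q) ℤ.- (a′ ℤ.* + p ℤ.+ b ℤ.* + q)   ≡⟨ after a′ b b′ (+ p) (+ q) ⟩
      ℤ.- ((b ℤ.- b′) ℤ.* + q)                                     ∎) ⟩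
    ∣ ℤ.- ((b ℤ.- b′) ℤ.* + q) ∣  ≡⟨ ℤ.∣-i∣≡∣i∣ ((b ℤ.- b′) ℤ.* + q) ⟩
    ∣ (b ℤ.- b′) ℤ.* + q ∣        ≡⟨ ℤ.abs-* (b ℤ.- b′) (+ q) ⟩
    ∣ b ℤ.- b′ ∣ ℕ.* q            ∎
    where
    open ≡-Reasoning
    before : ∀ a a′ b P Q → (a ℤ.- a′) ℤ.* P ≡ (a ℤ.* P ℤ.+ b ℤ.* Q) ℤ.- (a′ ℤ.* P ℤ.+ b ℤ.* Q)
    before = solve-∀
    after : ∀ a′ b b′ P Q → (a′ ℤ.* P ℤ.+ b′ ℤ.* Q) ℤ.- (a′ ℤ.* P ℤ.+ b ℤ.* Q) ≡ ℤ.- ((b ℤ.- b′) ℤ.* Q)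
    after = solve-∀

  eq₁ = row a a′ b b′ (cong proj₁ eq)
  eq₂ = row c c′ d d′ (cong proj₂ eq)

  even₁ : 2 ∣ ∣ a ℤ.- a′ ∣
  even₁ = row-even {f = ∣ b ℤ.- b′ ∣} 0<p p<q ≤2 eq₁

  even₂ : 2 ∣ ∣ c ℤ.- c′ ∣
  even₂ = row-even {f = ∣ d ℤ.- d′ ∣} 0<p p<q ≤2′ eq₂

  transfer : ∀ i i′ j j′ → + 2 ℤ.∣ i ℤ.+ j → + 2 ℤ.∣ i′ ℤ.+ j′ →
             2 ∣ ∣ i ℤ.- i′ ∣ → 2 ∣ ∣ j ℤ.- j′ ∣
  transfer i i′ j j′ s s′ even = ℤ.∣⇒∣ᵤ {+ 2} {j ℤ.- j′} (ℤ.∣m+n∣m⇒∣n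
    (subst (+ 2 ℤ.∣_) (difference i i′ j j′) (ℤ.∣m∣n⇒∣m-n s s′)) (ℤ.∣ᵤ⇒∣ {+ 2} {i ℤ.- i′} even))
    where
    difference : ∀ i i′ j j′ → (i ℤ.+ j) ℤ.- (i′ ℤ.+ j′) ≡ (i ℤ.- i′) ℤ.+ (j ℤ.- j′)
    difference = solve-∀

  row₁ : ∣ a ℤ.- a′ ∣ ≡ 0 × ∣ b ℤ.- b′ ∣ ≡ 0
  row₁ = row-zero 0<p p<q ≤2 even₁
    (transfer c c′ b b′ (subst (+ 2 ℤ.∣_) (ℤ.+-comm b c) x′)
                        (subst (+ 2 ℤ.∣_) (ℤ.+-comm b′ c′) z′) even₂) eq₁

  row₂ : ∣ c ℤ.- c′ ∣ ≡ 0 × ∣ d ℤ.- d′ ∣ ≡ 0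
  row₂ = row-zero 0<p p<q ≤2′ even₂ (transfer a a′ d d′ x z even₁) eq₂

-- The properties, shared by the zero matrix and the direction matrices,
-- that allow a shift by S to be recognized from its effect on (p, q).
record Small (S : Matrix) : Set where
  constructor small
  field
    ∣a₁₁∣≤1   : ∣ a₁₁ S ∣ ℕ.≤ 1
    ∣a₂₁∣≤1   : ∣ a₂₁ S ∣ ℕ.≤ 1
    checkered : Checkered S

private
  0≤1 : 0 ℕ.≤ 1
  0≤1 = ℕ.z≤n
  1≤1 : 1 ℕ.≤ 1
  1≤1 = ℕ.s≤s ℕ.z≤n

0ᴹ-small : Small 0ᴹ
0ᴹ-small = small 0≤1 0≤1 (ℤ.divides 0ℤ refl , ℤ.divides 0ℤ refl)

A-small : ∀ i → Small (A i)
A-small d₁ = small 0≤1 1≤1 (ℤ.divides 0ℤ refl , ℤ.divides 1ℤ refl)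
A-small d₂ = small 1≤1 0≤1 (ℤ.divides 1ℤ refl , ℤ.divides 0ℤ refl)
A-small d₃ = small 1≤1 0≤1 (ℤ.divides 0ℤ refl , ℤ.divides 0ℤ refl)
A-small d₄ = small 0≤1 1≤1 (ℤ.divides 0ℤ refl , ℤ.divides 0ℤ refl)
A-small d₅ = small 0≤1 1≤1 (ℤ.divides 0ℤ refl , ℤ.divides -1ℤ refl)
A-small d₆ = small 1≤1 0≤1 (ℤ.divides -1ℤ refl , ℤ.divides 0ℤ refl)
A-small d₇ = small 1≤1 0≤1 (ℤ.divides 0ℤ refl , ℤ.divides 0ℤ refl)
A-small d₈ = small 0≤1 1≤1 (ℤ.divides 0ℤ refl , ℤ.divides 0ℤ refl)

0or-1 : ℤ → Set
0or-1 z = z ≡ 0ℤ ⊎ z ≡ -1ℤ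

place-a₁₁ : ∀ r k l → 0or-1 (a₁₁ (place r k l))
place-a₁₁ I   k l = inj₁ refl
place-a₁₁ II  k l = inj₂ refl
place-a₁₁ III k l = inj₂ refl
place-a₁₁ IV  k l = inj₁ refl

place-a₂₁ : ∀ r k l → 0or-1 (a₂₁ (place r k l))
place-a₂₁ I   k l = inj₁ refl
place-a₂₁ II  k l = inj₁ refl
place-a₂₁ III k l = inj₂ refl
place-a₂₁ IV  k l = inj₂ refl

-- A shift observed between squares of an actual leaper is a shift between
-- the positions of the cells.
shift-determined : ∀ {p q n S} → 0 ℕ.< p → p ℕ.< q → Small S → (x y : Cell n) →
  position y · (+ p , + q) ≡ (position x +ᴹ S) · (+ p , + q) →
  position y ≡ position x +ᴹ S
shift-determined {S = S@(mat s _ s′ _)} 0<p p<q (small ≤1 ≤1′ checkered)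
  (cell r k l _) (cell r′ k′ l′ _) = agree 0<p p<q
    (place-checkered r′ k′ l′) (checkered-+ (place-checkered r k l) checkered)
    (within-2 (place-a₁₁ r′ k′ l′) (place-a₁₁ r k l) ≤1)
    (within-2 (place-a₂₁ r′ k′ l′) (place-a₂₁ r k l) ≤1′)
  where
  within-1 : ∀ {i j} → 0or-1 i → 0or-1 j → ∣ i ℤ.- j ∣ ℕ.≤ 1
  within-1 (inj₁ refl) (inj₁ refl) = 0≤1
  within-1 (inj₁ refl) (inj₂ refl) = 1≤1
  within-1 (inj₂ refl) (inj₁ refl) = 1≤1
  within-1 (inj₂ refl) (inj₂ refl) = 0≤1

  regroup : ∀ i j s → (i ℤ.- j) ℤ.- s ≡ i ℤ.- (j ℤ.+ s)
  regroup = solve-∀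

  within-2 : ∀ {i j s} → 0or-1 i → 0or-1 j → ∣ s ∣ ℕ.≤ 1 → ∣ i ℤ.- (j ℤ.+ s) ∣ ℕ.≤ 2
  within-2 {i} {j} {s} i∈ j∈ s≤1 = subst (λ z → ∣ z ∣ ℕ.≤ 2) (regroup i j s)
    (ℕ.≤-trans (ℤ.∣i-j∣≤∣i∣+∣j∣ (i ℤ.- j) s) (ℕ.+-mono-≤ (within-1 i∈ j∈) s≤1))

-- The pinwheel board of a leaper.

≤-scaled⇔ : ∀ {i j i′ j′} d .{{_ : ℤ.Positive d}} →
            j′ ℤ.- i′ ≡ (j ℤ.- i) ℤ.* d → i ℤ.≤ j ⇔ i′ ℤ.≤ j′
≤-scaled⇔ {i} {j} {i′} {j′} d eq = mk⇔
  (λ i≤j → ℤ.0≤i-j⇒j≤i (subst (0ℤ ℤ.≤_) (sym eq)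
    (ℤ.*-monoʳ-≤-nonNeg d {{ℤ.nonNegative (ℤ.<⇒≤ (ℤ.positive⁻¹ d))}} (ℤ.i≤j⇒0≤j-i i≤j))))
  (λ i′≤j′ → ℤ.0≤i-j⇒j≤i (ℤ.*-cancelʳ-≤-pos 0ℤ (j ℤ.- i) d
    (subst (0ℤ ℤ.≤_) eq (ℤ.i≤j⇒0≤j-i i′≤j′))))

⊖⇒⊕ : ∀ s t {u} → t ⊖ s ≡ u → t ≡ s ⊕ u
⊖⇒⊕ s t refl = cong₂ _,_ (e (proj₁ s) (proj₁ t)) (e (proj₂ s) (proj₂ t))
  where
  e : ∀ i j → j ≡ i ℤ.+ (j ℤ.- i)
  e = solve-∀

⊕⇒⊖ : ∀ s u {t} → t ≡ s ⊕ u → t ⊖ s ≡ u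
⊕⇒⊖ s u refl = cong₂ _,_ (e (proj₁ s) (proj₁ u)) (e (proj₂ s) (proj₂ u))
  where
  e : ∀ i j → (i ℤ.+ j) ℤ.- i ≡ j
  e = solve-∀

4*-positive : ∀ {q} → 0 < q → ℤ.Positive (+ 4 ℤ.* + q)
4*-positive {suc q} _ = _

module _ (n : ℕ) (L : Leaper) (p<q : p L < q L) where

  private
    P Q N : ℤ
    P = + p L
    Q = + q L
    N = + n

    v : ℤ × ℤ
    v = P , Q

    instance
      4Q-positive : ℤ.Positive (+ 4 ℤ.* Q)
      4Q-positive = 4*-positive (ℕ.≤-<-trans ℕ.z≤n p<q)

  Wᴵ? : ∀ c → Dec (Wᴵ n L c)
  Wᴵ? (X , Y) = ((_ ∣? _) ×-dec (_ ∣? _)) ×-dec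
    ((_ ℤ.≤? _) ×-dec (_ ℤ.≤? _) ×-dec (_ ℤ.≤? _) ×-dec (_ ℤ.≤? _))

  -- The clockwise rotation that takes board r to the first board; the
  -- formulas are those obtained by iterating the quarter-turn.
  unrotate : Quadrant → ℤ × ℤ → ℤ × ℤ
  unrotate I   c       = c
  unrotate II  (X , Y) = Y , ℤ.- X
  unrotate III (X , Y) = ℤ.- X , ℤ.- Y
  unrotate IV  (X , Y) = ℤ.- Y , ℤ.- (ℤ.- X)

  board? : ∀ s → Dec (pinwheelBoard n L s)
  board? s = on I ⊎-dec on II ⊎-dec on III ⊎-dec on IV
    where
    on : ∀ r → Dec (Wᴵ n L (unrotate r (center L s)))
    on r = Wᴵ? (unrotate r (center L s))

  -- The points of the lattice that contains the doubled centers of the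
  -- first board.
  lattice : ℤ → ℤ → ℤ × ℤ
  lattice k l = (P ℤ.+ Q) ℤ.+ k ℤ.* (+ 4 ℤ.* Q) , (P ℤ.- Q) ℤ.+ l ℤ.* (+ 4 ℤ.* Q)

  lattice-Rᴵ⇔ : ∀ k l → Box N k l ⇔ Rᴵ n L (lattice k l)
  lattice-Rᴵ⇔ k l = mk⇔
    (λ { (box a b c d) → to c₁ a , to c₂ b , to c₃ c , to c₄ d })
    (λ { (a , b , c , d) → box (from c₁ a) (from c₂ b) (from c₃ c) (from c₄ d) })
    where
    open Equivalence
    e₁ : ∀ P Q k l →
      (((P ℤ.+ Q) ℤ.+ k ℤ.* (+ 4 ℤ.* Q)) ℤ.+ ((P ℤ.- Q) ℤ.+ l ℤ.* (+ 4 ℤ.* Q))) ℤ.- + 2 ℤ.* P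
      ≡ ((k ℤ.+ l) ℤ.- 0ℤ) ℤ.* (+ 4 ℤ.* Q)
    e₁ = solve-∀
    e₂ : ∀ P Q N k l →
      + 2 ℤ.* (P ℤ.+ + 2 ℤ.* N ℤ.* Q) ℤ.-
      (((P ℤ.+ Q) ℤ.+ k ℤ.* (+ 4 ℤ.* Q)) ℤ.+ ((P ℤ.- Q) ℤ.+ l ℤ.* (+ 4 ℤ.* Q)))
      ≡ (N ℤ.- (k ℤ.+ l)) ℤ.* (+ 4 ℤ.* Q)
    e₂ = solve-∀
    e₃ : ∀ P Q N k l →
      (((P ℤ.- Q) ℤ.+ l ℤ.* (+ 4 ℤ.* Q)) ℤ.- ((P ℤ.+ Q) ℤ.+ k ℤ.* (+ 4 ℤ.* Q))) ℤ.-
      ℤ.- (+ 2 ℤ.* ((+ 2 ℤ.* N ℤ.- 1ℤ) ℤ.* Q))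
      ≡ ((l ℤ.- k) ℤ.- (1ℤ ℤ.- N)) ℤ.* (+ 4 ℤ.* Q)
    e₃ = solve-∀
    e₄ : ∀ P Q N k l →
      + 2 ℤ.* ((+ 2 ℤ.* N ℤ.- 1ℤ) ℤ.* Q) ℤ.-
      (((P ℤ.- Q) ℤ.+ l ℤ.* (+ 4 ℤ.* Q)) ℤ.- ((P ℤ.+ Q) ℤ.+ k ℤ.* (+ 4 ℤ.* Q)))
      ≡ (N ℤ.- (l ℤ.- k)) ℤ.* (+ 4 ℤ.* Q)
    e₄ = solve-∀
    c₁ = ≤-scaled⇔ (+ 4 ℤ.* Q) (e₁ P Q k l)
    c₂ = ≤-scaled⇔ (+ 4 ℤ.* Q) (e₂ P Q N k l)
    c₃ = ≤-scaled⇔ (+ 4 ℤ.* Q) (e₃ P Q N k l)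
    c₄ = ≤-scaled⇔ (+ 4 ℤ.* Q) (e₄ P Q N k l)

  lattice∈Wᴵ : ∀ {k l} → Box N k l → Wᴵ n L (lattice k l)
  lattice∈Wᴵ {k} {l} b =
    (ℤ.∣⇒∣ᵤ (ℤ.divides k (cancel (P ℤ.+ Q) (k ℤ.* (+ 4 ℤ.* Q)))) ,
     ℤ.∣⇒∣ᵤ (ℤ.divides l (cancel (P ℤ.- Q) (l ℤ.* (+ 4 ℤ.* Q))))) ,
    Equivalence.to (lattice-Rᴵ⇔ k l) b
    where
    cancel : ∀ c z → (c ℤ.+ z) ℤ.- c ≡ z
    cancel = solve-∀

  Wᴵ⊆lattice : ∀ c → Wᴵ n L c → ∃[ k ] ∃[ l ] (Box N k l × lattice k l ≡ c)
  Wᴵ⊆lattice (X , Y) ((divX , divY) , rect)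
    with ℤ.divides k X≡ ← ℤ.∣ᵤ⇒∣ {+ 4 ℤ.* Q} {X ℤ.- (P ℤ.+ Q)} divX
       | ℤ.divides l Y≡ ← ℤ.∣ᵤ⇒∣ {+ 4 ℤ.* Q} {Y ℤ.- (P ℤ.- Q)} divY
    = k , l , Equivalence.from (lattice-Rᴵ⇔ k l) (subst (Rᴵ n L) (sym eq) rect) , eq
    where
    restore : ∀ c z → c ℤ.+ (z ℤ.- c) ≡ z
    restore = solve-∀
    eq : lattice k l ≡ (X , Y)
    eq = cong₂ _,_
      (trans (cong (λ z → (P ℤ.+ Q) ℤ.+ z) (sym X≡)) (restore (P ℤ.+ Q) X))
      (trans (cong (λ z → (P ℤ.- Q) ℤ.+ z) (sym Y≡)) (restore (P ℤ.- Q) Y))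

  -- The doubled center of the square with position M.
  centerAt : Matrix → ℤ × ℤ
  centerAt (mat a b c d) = (P ℤ.+ Q) ℤ.+ + 2 ℤ.* (a ℤ.* P ℤ.+ b ℤ.* Q) ,
                           (P ℤ.- Q) ℤ.+ + 2 ℤ.* (c ℤ.* P ℤ.+ d ℤ.* Q)

  -- The square with position zero: its doubled center is (p + q, p - q).
  base : Square
  base = + ((p L ℕ.+ q L) / 2) , + ((p L ℕ.+ q L) / 2) ℤ.- Q

  squareAt : Matrix → Square
  squareAt M = base ⊕ (M · v)

  center-squareAt : ∀ M → center L (squareAt M) ≡ centerAt M
  center-squareAt (mat a b c d) = cong₂ _,_
    (trans (regroup H R (a ℤ.* P ℤ.+ b ℤ.* Q)) (cong (λ z → z ℤ.+ + 2 ℤ.* (a ℤ.* P ℤ.+ b ℤ.* Q)) R+2H))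
    (trans (regroup′ H R Q (c ℤ.* P ℤ.+ d ℤ.* Q))
           (trans (cong (λ z → z ℤ.- + 2 ℤ.* Q ℤ.+ + 2 ℤ.* (c ℤ.* P ℤ.+ d ℤ.* Q)) R+2H)
                  (simplify P Q (c ℤ.* P ℤ.+ d ℤ.* Q))))
    where
    H R : ℤ
    H = + ((p L ℕ.+ q L) / 2)
    R = + ((p L ℕ.+ q L) % 2)
    R+2H : R ℤ.+ H ℤ.* + 2 ≡ P ℤ.+ Q
    R+2H = trans (cong (λ z → R ℤ.+ z) (sym (ℤ.pos-* ((p L ℕ.+ q L) / 2) 2)))
                 (cong +_ (sym (m≡m%n+[m/n]*n (p L ℕ.+ q L) 2)))
    regroup : ∀ H R z → + 2 ℤ.* (H ℤ.+ z) ℤ.+ R ≡ (R ℤ.+ H ℤ.* + 2) ℤ.+ + 2 ℤ.* z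
    regroup = solve-∀
    regroup′ : ∀ H R Q z → + 2 ℤ.* (H ℤ.- Q ℤ.+ z) ℤ.+ R ≡
               (R ℤ.+ H ℤ.* + 2) ℤ.- + 2 ℤ.* Q ℤ.+ + 2 ℤ.* z
    regroup′ = solve-∀
    simplify : ∀ P Q z → (P ℤ.+ Q) ℤ.- + 2 ℤ.* Q ℤ.+ + 2 ℤ.* z ≡ (P ℤ.- Q) ℤ.+ + 2 ℤ.* z
    simplify = solve-∀

  center-injective : ∀ s t → center L s ≡ center L t → s ≡ t
  center-injective (a , b) (a′ , b′) eq =
    cong₂ _,_ (halve a a′ (cong proj₁ eq)) (halve b b′ (cong proj₂ eq))
    where
    R : ℤ
    R = + ((p L ℕ.+ q L) % 2)
    halve : ∀ i j → + 2 ℤ.* i ℤ.+ R ≡ + 2 ℤ.* j ℤ.+ R → i ≡ j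
    halve i j eq = ℤ.*-cancelˡ-≡ (+ 2) i j (+-cancelʳ R (+ 2 ℤ.* i) (+ 2 ℤ.* j) eq)

  unrotate-injective : ∀ r c c′ → unrotate r c ≡ unrotate r c′ → c ≡ c′
  unrotate-injective I   c c′ eq = eq
  unrotate-injective II  c c′ eq = cong₂ _,_ (ℤ.neg-injective (cong proj₂ eq)) (cong proj₁ eq)
  unrotate-injective III c c′ eq = cong₂ _,_ (ℤ.neg-injective (cong proj₁ eq)) (ℤ.neg-injective (cong proj₂ eq))
  unrotate-injective IV  c c′ eq = cong₂ _,_ (ℤ.neg-injective (ℤ.neg-injective (cong proj₂ eq))) (ℤ.neg-injective (cong proj₁ eq))

  unrotate-centerAt : ∀ r k l → unrotate r (centerAt (place r k l)) ≡ lattice k l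
  unrotate-centerAt I k l = cong₂ _,_ (e₁ P Q k) (e₂ P Q l)
    where
    e₁ : ∀ P Q k → (P ℤ.+ Q) ℤ.+ + 2 ℤ.* (0ℤ ℤ.* P ℤ.+ (0ℤ ℤ.+ + 2 ℤ.* k) ℤ.* Q) ≡
                   (P ℤ.+ Q) ℤ.+ k ℤ.* (+ 4 ℤ.* Q)
    e₁ = solve-∀
    e₂ : ∀ P Q l → (P ℤ.- Q) ℤ.+ + 2 ℤ.* (0ℤ ℤ.* P ℤ.+ (0ℤ ℤ.+ + 2 ℤ.* l) ℤ.* Q) ≡
                   (P ℤ.- Q) ℤ.+ l ℤ.* (+ 4 ℤ.* Q)
    e₂ = solve-∀
  unrotate-centerAt II k l = cong₂ _,_ (e₁ P Q k) (e₂ P Q l)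
    where
    e₁ : ∀ P Q k → (P ℤ.- Q) ℤ.+ + 2 ℤ.* (0ℤ ℤ.* P ℤ.+ (1ℤ ℤ.+ + 2 ℤ.* k) ℤ.* Q) ≡
                   (P ℤ.+ Q) ℤ.+ k ℤ.* (+ 4 ℤ.* Q)
    e₁ = solve-∀
    e₂ : ∀ P Q l → ℤ.- ((P ℤ.+ Q) ℤ.+ + 2 ℤ.* (-1ℤ ℤ.* P ℤ.+ (0ℤ ℤ.- + 2 ℤ.* l) ℤ.* Q)) ≡
                   (P ℤ.- Q) ℤ.+ l ℤ.* (+ 4 ℤ.* Q)
    e₂ = solve-∀
  unrotate-centerAt III k l = cong₂ _,_ (e₁ P Q k) (e₂ P Q l)
    where
    e₁ : ∀ P Q k → ℤ.- ((P ℤ.+ Q) ℤ.+ + 2 ℤ.* (-1ℤ ℤ.* P ℤ.+ (-1ℤ ℤ.- + 2 ℤ.* k) ℤ.* Q)) ≡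
                   (P ℤ.+ Q) ℤ.+ k ℤ.* (+ 4 ℤ.* Q)
    e₁ = solve-∀
    e₂ : ∀ P Q l → ℤ.- ((P ℤ.- Q) ℤ.+ + 2 ℤ.* (-1ℤ ℤ.* P ℤ.+ (1ℤ ℤ.- + 2 ℤ.* l) ℤ.* Q)) ≡
                   (P ℤ.- Q) ℤ.+ l ℤ.* (+ 4 ℤ.* Q)
    e₂ = solve-∀
  unrotate-centerAt IV k l = cong₂ _,_ (e₁ P Q k) (e₂ P Q l)
    where
    e₁ : ∀ P Q k → ℤ.- ((P ℤ.- Q) ℤ.+ + 2 ℤ.* (-1ℤ ℤ.* P ℤ.+ (0ℤ ℤ.- + 2 ℤ.* k) ℤ.* Q)) ≡
                   (P ℤ.+ Q) ℤ.+ k ℤ.* (+ 4 ℤ.* Q)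
    e₁ = solve-∀
    e₂ : ∀ P Q l → ℤ.- (ℤ.- ((P ℤ.+ Q) ℤ.+ + 2 ℤ.* (0ℤ ℤ.* P ℤ.+ (-1ℤ ℤ.+ + 2 ℤ.* l) ℤ.* Q))) ≡
                   (P ℤ.- Q) ℤ.+ l ℤ.* (+ 4 ℤ.* Q)
    e₂ = solve-∀

  unrotate⇒board : ∀ r s → Wᴵ n L (unrotate r (center L s)) → pinwheelBoard n L s
  unrotate⇒board I   s w = inj₁ w
  unrotate⇒board II  s w = inj₂ (inj₁ w)
  unrotate⇒board III s w = inj₂ (inj₂ (inj₁ w))
  unrotate⇒board IV  s w = inj₂ (inj₂ (inj₂ w))

  board⇒unrotate : ∀ s → pinwheelBoard n L s → ∃[ r ] Wᴵ n L (unrotate r (center L s))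
  board⇒unrotate s (inj₁ w)                = I , w
  board⇒unrotate s (inj₂ (inj₁ w))         = II , w
  board⇒unrotate s (inj₂ (inj₂ (inj₁ w)))  = III , w
  board⇒unrotate s (inj₂ (inj₂ (inj₂ w)))  = IV , w

  square : Cell n → Square
  square x = squareAt (position x)

  unrotate-center : ∀ r k l → unrotate r (center L (squareAt (place r k l))) ≡ lattice k l
  unrotate-center r k l =
    trans (cong (unrotate r) (center-squareAt (place r k l))) (unrotate-centerAt r k l)

  square∈board : ∀ r {k l} → Box N k l → pinwheelBoard n L (squareAt (place r k l))
  square∈board r {k} {l} b = unrotate⇒board r (squareAt (place r k l))
    (subst (Wᴵ n L) (sym (unrotate-center r k l)) (lattice∈Wᴵ b))

  locate : ∀ s → pinwheelBoard n L s → ∃[ x ] square x ≡ s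
  locate s s∈ = on-board (board⇒unrotate s s∈)
    where
    at : ∀ r → ∃[ k ] ∃[ l ] (Box N k l × lattice k l ≡ unrotate r (center L s)) →
         ∃[ x ] square x ≡ s
    at r (k , l , b , eq) = cell r k l b , center-injective (squareAt (place r k l)) s
      (unrotate-injective r (center L (squareAt (place r k l))) (center L s)
        (trans (unrotate-center r k l) eq))

    on-board : ∃[ r ] Wᴵ n L (unrotate r (center L s)) → ∃[ x ] square x ≡ s
    on-board (r , w) = at r (Wᴵ⊆lattice (unrotate r (center L s)) w)

  -- The leaper graph and its squares as cells.

  G : SquareGraph
  G = leaperGraph L (pinwheelBoard n L)

  toSquare : Cell n → SquareOf G
  toSquare (cell r k l b) = squareAt (place r k l) , [ square∈board r b ]

  toCell : SquareOf G → Cell n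
  toCell (s , [ s∈ ]) = proj₁ (locate s (recompute (board? s) s∈))

  square-toCell : ∀ s → square (toCell s) ≡ value s
  square-toCell (s , [ s∈ ]) = proj₂ (locate s (recompute (board? s) s∈))

  ·-distrib : ∀ X Y → (X +ᴹ Y) · v ≡ (X · v) ⊕ (Y · v)
  ·-distrib (mat a b c d) (mat a′ b′ c′ d′) =
    cong₂ _,_ (e a a′ b b′ P Q) (e c c′ d d′ P Q)
    where
    e : ∀ a a′ b b′ P Q → (a ℤ.+ a′) ℤ.* P ℤ.+ (b ℤ.+ b′) ℤ.* Q ≡
        (a ℤ.* P ℤ.+ b ℤ.* Q) ℤ.+ (a′ ℤ.* P ℤ.+ b′ ℤ.* Q)
    e = solve-∀

  ⊕-assoc : ∀ s t u → s ⊕ (t ⊕ u) ≡ (s ⊕ t) ⊕ u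
  ⊕-assoc (a , b) (a′ , b′) (a″ , b″) =
    cong₂ _,_ (sym (ℤ.+-assoc a a′ a″)) (sym (ℤ.+-assoc b b′ b″))

  ⊕-cancelˡ : ∀ s t u → s ⊕ t ≡ s ⊕ u → t ≡ u
  ⊕-cancelˡ (a , b) (a′ , b′) (a″ , b″) eq =
    cong₂ _,_ (+-cancelˡ a a′ a″ (cong proj₁ eq)) (+-cancelˡ b b′ b″ (cong proj₂ eq))

  squareAt-shift : ∀ X S → squareAt (X +ᴹ S) ≡ squareAt X ⊕ (S · v)
  squareAt-shift X S =
    trans (cong (base ⊕_) (·-distrib X S)) (⊕-assoc base (X · v) (S · v))

  instantiation : IsInstantiation L (pinwheel n) G
  instantiation = toSquare , λ { (cell r k l _) i (cell _ _ _ _) (arc eq) →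
    trans (cong squareAt eq) (squareAt-shift (place r k l) (A i)) }

  -- The entry 1 or -1 of a direction matrix.
  unit : Sign → ℤ
  unit Sign.+ = 1ℤ
  unit Sign.- = -1ℤ

  pos-first : ∀ x y → x ≡ 1ℤ ℤ.* x ℤ.+ 0ℤ ℤ.* y
  pos-first = solve-∀
  neg-first : ∀ x y → ℤ.- x ≡ -1ℤ ℤ.* x ℤ.+ 0ℤ ℤ.* y
  neg-first = solve-∀
  pos-second : ∀ x y → y ≡ 0ℤ ℤ.* x ℤ.+ 1ℤ ℤ.* y
  pos-second = solve-∀
  neg-second : ∀ x y → ℤ.- y ≡ 0ℤ ℤ.* x ℤ.+ -1ℤ ℤ.* y
  neg-second = solve-∀

  ±p : ∀ s → s ◃ p L ≡ unit s ℤ.* P ℤ.+ 0ℤ ℤ.* Q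
  ±p Sign.+ = trans (ℤ.+◃n≡+n (p L)) (pos-first P Q)
  ±p Sign.- = trans (ℤ.-◃n≡-n (p L)) (neg-first P Q)

  ±q : ∀ s → s ◃ q L ≡ 0ℤ ℤ.* P ℤ.+ unit s ℤ.* Q
  ±q Sign.+ = trans (ℤ.+◃n≡+n (q L)) (pos-second P Q)
  ±q Sign.- = trans (ℤ.-◃n≡-n (q L)) (neg-second P Q)

  pq-move : ∀ s t → (s ◃ p L , t ◃ q L) ≡ mat (unit s) 0ℤ 0ℤ (unit t) · v
  pq-move s t = cong₂ _,_ (±p s) (±q t)

  qp-move : ∀ s t → (s ◃ q L , t ◃ p L) ≡ mat 0ℤ (unit s) (unit t) 0ℤ · v
  qp-move s t = cong₂ _,_ (±q s) (±p t)

  move-direction : ∀ {u} → IsMove L u → ∃[ i ] u ≡ directionVector L i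
  move-direction (Sign.+ , Sign.+ , inj₁ eq) = d₂ , trans eq (pq-move Sign.+ Sign.+)
  move-direction (Sign.- , Sign.+ , inj₁ eq) = d₃ , trans eq (pq-move Sign.- Sign.+)
  move-direction (Sign.- , Sign.- , inj₁ eq) = d₆ , trans eq (pq-move Sign.- Sign.-)
  move-direction (Sign.+ , Sign.- , inj₁ eq) = d₇ , trans eq (pq-move Sign.+ Sign.-)
  move-direction (Sign.+ , Sign.+ , inj₂ eq) = d₁ , trans eq (qp-move Sign.+ Sign.+)
  move-direction (Sign.- , Sign.+ , inj₂ eq) = d₄ , trans eq (qp-move Sign.- Sign.+)
  move-direction (Sign.- , Sign.- , inj₂ eq) = d₅ , trans eq (qp-move Sign.- Sign.-)
  move-direction (Sign.+ , Sign.- , inj₂ eq) = d₈ , trans eq (qp-move Sign.+ Sign.-)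

  direction-move : ∀ i → IsMove L (directionVector L i)
  direction-move d₁ = Sign.+ , Sign.+ , inj₂ (sym (qp-move Sign.+ Sign.+))
  direction-move d₂ = Sign.+ , Sign.+ , inj₁ (sym (pq-move Sign.+ Sign.+))
  direction-move d₃ = Sign.- , Sign.+ , inj₁ (sym (pq-move Sign.- Sign.+))
  direction-move d₄ = Sign.- , Sign.+ , inj₂ (sym (qp-move Sign.- Sign.+))
  direction-move d₅ = Sign.- , Sign.- , inj₂ (sym (qp-move Sign.- Sign.-))
  direction-move d₆ = Sign.- , Sign.- , inj₁ (sym (pq-move Sign.- Sign.-))
  direction-move d₇ = Sign.+ , Sign.- , inj₁ (sym (pq-move Sign.+ Sign.-))
  direction-move d₈ = Sign.+ , Sign.- , inj₂ (sym (qp-move Sign.+ Sign.-))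

  module _ (0<p : 0 < p L) where

    -- For p = 0 this fails: the directions d₂ and d₃ give equal translations.
    square-shift⇒ : ∀ {S} → Small S → ∀ x y → square y ≡ square x ⊕ (S · v) →
                    position y ≡ position x +ᴹ S
    square-shift⇒ {S} S-small x y eq = shift-determined 0<p p<q S-small x y
      (⊕-cancelˡ base (position y · v) ((position x +ᴹ S) · v)
        (trans eq (sym (squareAt-shift (position x) S))))

    square-injective : ∀ x y → square x ≡ square y → x ≡ y
    square-injective x y eq = position-injective (sym (begin
      position y          ≡⟨ square-shift⇒ 0ᴹ-small x y (begin
        square y                   ≡⟨ eq ⟨
        square x                   ≡⟨ cong squareAt (+ᴹ-identityʳ (position x)) ⟨
        squareAt (position x +ᴹ 0ᴹ) ≡⟨ squareAt-shift (position x) 0ᴹ ⟩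
        square x ⊕ (0ᴹ · v)        ∎) ⟩
      position x +ᴹ 0ᴹ    ≡⟨ +ᴹ-identityʳ (position x) ⟩
      position x          ∎))
      where open ≡-Reasoning

    square↔cell : SquareOf G ↔ Cell n
    square↔cell = mk↔ₛ′ toCell toSquare
      (λ { x@(cell _ _ _ _) → square-injective (toCell (toSquare x)) x (square-toCell (toSquare x)) })
      (λ s → value-injective (trans (value-toSquare (toCell s)) (square-toCell s)))
      where
      value-toSquare : ∀ x → value (toSquare x) ≡ square x
      value-toSquare (cell _ _ _ _) = refl

    move⇔shift : ∀ (a b : SquareOf G) i →
      value b ⊖ value a ≡ directionVector L i ⇔
      position (toCell b) ≡ position (toCell a) +ᴹ A i
    move⇔shift a b i = mk⇔
      (λ eq → square-shift⇒ (A-small i) (toCell a) (toCell b) (begin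
        square (toCell b)                          ≡⟨ square-toCell b ⟩
        value b                                    ≡⟨ ⊖⇒⊕ (value a) (value b) eq ⟩
        value a ⊕ directionVector L i              ≡⟨ cong (_⊕ directionVector L i) (square-toCell a) ⟨
        square (toCell a) ⊕ directionVector L i    ∎))
      (λ eq → ⊕⇒⊖ (value a) (directionVector L i) (begin
        value b                                    ≡⟨ square-toCell b ⟨
        square (toCell b)                          ≡⟨ cong squareAt eq ⟩
        squareAt (position (toCell a) +ᴹ A i)      ≡⟨ squareAt-shift (position (toCell a)) (A i) ⟩
        square (toCell a) ⊕ directionVector L i    ≡⟨ cong (_⊕ directionVector L i) (square-toCell a) ⟩
        value a ⊕ directionVector L i              ∎))
      where open ≡-Reasoning

    extracted≅pinwheel : extracted L (pinwheelBoard n L) ≅ pinwheel n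
    extracted≅pinwheel = square↔cell , λ a i b → mk⇔
      (λ { (_ , eq) → arc (Equivalence.to (move⇔shift a b i) eq) })
      (λ { (arc eq) → let moved = Equivalence.from (move⇔shift a b i) eq in
                      subst (IsMove L) (sym moved) (direction-move i) , moved })

    -- The moves of w have the directions is, and the matrices of these add up
    -- to the change of position along w.
    HasDirections : ∀ a b → Walk (Adjacent G) a b → List Direction → Set
    HasDirections a b w is =
      Directions L (pinwheelBoard n L) w is ×
      position (toCell b) ≡ position (toCell a) +ᴹ matrixSum is

    prepend : ∀ a c b {m : Adjacent G a c} {w : Walk (Adjacent G) c b} {i is} →
              value c ⊖ value a ≡ directionVector L i →
              HasDirections c b w is → HasDirections a b (m ◅ w) (i ∷ is)
    prepend a c b {i = i} {is} eq (dirs , sum) = eq ∷ dirs , (begin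
      position (toCell b)                             ≡⟨ sum ⟩
      position (toCell c) +ᴹ matrixSum is             ≡⟨ cong (_+ᴹ matrixSum is) (Equivalence.to (move⇔shift a c i) eq) ⟩
      position (toCell a) +ᴹ A i +ᴹ matrixSum is      ≡⟨ +ᴹ-assoc (position (toCell a)) (A i) (matrixSum is) ⟩
      position (toCell a) +ᴹ (A i +ᴹ matrixSum is)    ∎)
      where open ≡-Reasoning

    walk-directions : ∀ {a b} (w : Walk (Adjacent G) a b) → ∃[ is ] HasDirections a b w is
    walk-directions {a} ε = [] , [] , sym (+ᴹ-identityʳ (position (toCell a)))
    walk-directions {a} {b} (_◅_ {j = c} m w) =
      let i  , eq   = move-direction m
          is , rest = walk-directions w in
      i ∷ is , prepend a c b eq rest

    -- The change of position around any closed walk, simple or not, is zero.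
    leaperGraph-trivial : IsTrivialLeaperGraph L (pinwheelBoard n L)
    leaperGraph-trivial {a} w _ = let is , dirs , sum = walk-directions w in
      is , dirs , +ᴹ-cancelˡ (position (toCell a))
        (trans (sym sum) (sym (+ᴹ-identityʳ (position (toCell a)))))

theorem24 : (n : ℕ) → 0 < n →
    Σ[ W ∈ LabeledDigraph ]
    ( IsDirectionGraph W
    × ((L : Leaper) → IsSkew L → p L < q L →
    IsTrivialLeaperGraph L (pinwheelBoard n L)
    × extracted L (pinwheelBoard n L) ≅ W)
    × ((L : Leaper) → ¬ IsSkew L → p L < q L →
    IsInstantiation L W (leaperGraph L (pinwheelBoard n L)))
    × IsInducedBy πPinwheel 1ᴹ πPinwheelMatrix
    × (¬ 2 ∣ n → IsDual W (relabel πPinwheel W) (A-pinwheel n))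
    × (2 ∣ n → IsDual W (relabel πReflect (relabel πPinwheel W)) (A-pinwheel n)) )
theorem24 n 0<n =
    pinwheel n
  , Potential.isDirectionGraph (pinwheel-potential n)
  , (λ { L (p≢0 , _) p<q → let 0<p = ℕ.n≢0⇒n>0 p≢0 in
         leaperGraph-trivial n L p<q 0<p , extracted≅pinwheel n L p<q 0<p })
  , (λ L _ p<q → instantiation n L p<q)
  , πPinwheel-induced
  , odd-dual 0<n
  , even-dual 0<n
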